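{- Let $p>2$. There are constants $c,C>0$ depending only on $p$ such that for every sufficiently small $\varepsilon>0$ and every $n\ge C d/\varepsilon^p$ the following holds. Any randomized algorithm that, given $A\in\mathbb{R}^{n\times d}$, query access to the entries of an unknown $b\in\mathbb{R}^n$, and $f\in\mathsf{Lip}_1$, outputs $\hat x\in\mathbb{R}^d$ such that, for every such input, with probability at least $4/5$, $$\|f(A\hat x)-b\|_p^p\le \mathsf{OPT}+\varepsilon\big(\mathsf{OPT}+\|Ax^*\|_p^p\big),$$ must, on some input, make at least $c\,d/\varepsilon^p$ queries to the entries of $b$.
   Context: $\mathsf{Lip}_1$ is the set of $f:\mathbb{R}\to\mathbb{R}$ with $f(0)=0$ and $|f(x)-f(y)|\le|x-y|$; $f$ is applied entrywise to vectors. $\mathsf{OPT}:=\min_{x\in\mathbb{R}^d}\|f(Ax)-b\|_p^p$ and $x^*$ is a minimizer of $\|Ax\|_p^p$ among all $x$ attaining $\mathsf{OPT}$. -}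

module Defs where

open import Level using (0ℓ) renaming (suc to lsuc)
open import Algebra.Bundles using (CommutativeRing; RawSemiring; Semiring)
open import Algebra.Core using (Op₁)
import Algebra.Construct.NaturalChoice.Max as Max
import Algebra.Definitions.RawSemiring as RawSemiringDefinitions
open import Data.Fin.Base using (Fin; toℕ)
open import Data.Nat.Base using (ℕ; zero; suc; NonZero)
open import Data.Product.Base using (∃; ∃-syntax; _×_)
open import Data.Sum.Base using (_⊎_)
open import Data.Vec.Functional using (Vector; map; zipWith)
open import Relation.Binary.Bundles using (TotalOrder)
open import Relation.Binary.Core using (Rel)
open import Relation.Binary.PropositionalEquality using (_≢_)
open import Relation.Binary.Structures using (IsTotalOrder)
open import Relation.Nullary using (¬_)
open import Relation.Unary using (Pred; U; ∁; ⋃; _⊆_; _≐_; _∈_; _⊥_; Satisfiable)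

-- The real numbers, given axiomatically.  Classically these axioms determine
-- ℝ up to isomorphism.  As usual for total operations, _⁻¹ is
-- unconstrained at 0# and sup is unconstrained on sets that are
-- empty or unbounded above.
record CompleteOrderedField : Set₁ where
  infix  4 _≤_ _<_
  infixl 7 _/_
  infix  9 _⁻¹

  field
    commutativeRing : CommutativeRing 0ℓ 0ℓ

  open CommutativeRing commutativeRing public
    using ( Carrier; _≈_; _≉_; _+_; _*_; -_; _-_; 0#; 1#
          ; semiring )

  rawSemiring : RawSemiring 0ℓ 0ℓ
  rawSemiring = Semiring.rawSemiring semiring

  field
    _≤_          : Rel Carrier 0ℓ
    isTotalOrder : IsTotalOrder _≈_ _≤_
    0≉1          : 0# ≉ 1#
    +-monoʳ-≤    : ∀ z {x y} → x ≤ y → z + x ≤ z + y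
    *-nonNeg     : ∀ {x y} → 0# ≤ x → 0# ≤ y → 0# ≤ x * y
    _⁻¹          : Op₁ Carrier
    ⁻¹-cong      : ∀ {x y} → x ≈ y → x ⁻¹ ≈ y ⁻¹
    ⁻¹-inverseʳ  : ∀ {x} → x ≉ 0# → x * x ⁻¹ ≈ 1#

  UpperBound : Pred Carrier 0ℓ → Pred Carrier 0ℓ
  UpperBound S u = ∀ {x} → x ∈ S → x ≤ u

  IsSupremum : Pred Carrier 0ℓ → Pred Carrier 0ℓ
  IsSupremum S s = UpperBound S s × (∀ {u} → UpperBound S u → s ≤ u)

  field
    sup            : Pred Carrier 0ℓ → Carrier
    sup-isSupremum : ∀ {S} → Satisfiable S → Satisfiable (UpperBound S) →
                     IsSupremum S (sup S)

  totalOrder : TotalOrder 0ℓ 0ℓ 0ℓ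
  totalOrder = record { isTotalOrder = isTotalOrder }

  open Max totalOrder public using (_⊔_)
  open RawSemiringDefinitions rawSemiring public using (sum)
    renaming (_^_ to _^ⁿ_)

  _<_ : Rel Carrier 0ℓ
  x < y = ¬ (y ≤ x)

  _/_ : Carrier → Carrier → Carrier
  x / y = x * y ⁻¹

  ∣_∣ : Op₁ Carrier
  ∣ x ∣ = x ⊔ (- x)

  fromℕ : ℕ → Carrier
  fromℕ n = RawSemiringDefinitions._×_ rawSemiring n 1#

  -- The set of t ≥ 0 with t ≤ x ^ (m / k) for some rational m / k, where
  -- m / k ≤ p if x ≥ 1 and m / k ≥ p if x ≤ 1.  In both ranges
  -- x ^ (m / k) ≤ x ^ p, with x ^ p as the supremum.
  PowerCut : Carrier → Carrier → Pred Carrier 0ℓ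
  PowerCut x p t = 0# ≤ t × ∃[ m ] ∃[ k ] NonZero k × t ^ⁿ k ≤ x ^ⁿ m ×
    ( (1# ≤ x × fromℕ m ≤ p * fromℕ k)
    ⊎ (x ≤ 1# × p * fromℕ k ≤ fromℕ m) )

  -- Real powers; meaningful for a base x ≥ 0 and an exponent p > 0, in which
  -- case PowerCut x p is nonempty and bounded above.
  infixr 8 _^_
  _^_ : Carrier → Carrier → Carrier
  x ^ p = sup (PowerCut x p)

module Reals (ℝ : CompleteOrderedField) where

  open CompleteOrderedField ℝ public

  record ProbabilitySpace : Set₂ where
    field
      Ω          : Set
      Measurable : Pred (Pred Ω 0ℓ) (lsuc 0ℓ)
      ℙ          : Pred Ω 0ℓ → Carrier

      measurable-resp : ∀ {E F} → E ≐ F → Measurable E → Measurable F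
      measurable-U    : Measurable U
      measurable-∁    : ∀ {E} → Measurable E → Measurable (∁ E)
      measurable-⋃    : ∀ {E : ℕ → Pred Ω 0ℓ} → (∀ i → Measurable (E i)) →
                        Measurable (⋃ ℕ E)

      ℙ-resp     : ∀ {E F} → E ≐ F → Measurable E → ℙ E ≈ ℙ F
      ℙ-nonNeg   : ∀ {E} → Measurable E → 0# ≤ ℙ E
      ℙ-U        : ℙ U ≈ 1#
      -- The terms are nonnegative, so the sum of the series is the supremum
      -- of its partial sums.
      ℙ-additive : ∀ {E : ℕ → Pred Ω 0ℓ} → (∀ i → Measurable (E i)) →
                   (∀ {i j} → i ≢ j → E i ⊥ E j) →
                   IsSupremum (λ s → ∃[ k ] s ≈ sum {k} (λ i → ℙ (E (toℕ i))))
                              (ℙ (⋃ ℕ E))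

    -- For a measurable E the next two say ℙ E ≥ q and ℙ E > 0.  Phrasing them
    -- by inner and outer measure gives them a meaning for every E, so that no
    -- measurability need be imposed on algorithms.
    WithProbabilityAtLeast : Carrier → Pred (Pred Ω 0ℓ) (lsuc 0ℓ)
    WithProbabilityAtLeast q E = ∃[ F ] Measurable F × F ⊆ E × q ≤ ℙ F

    WithPositiveProbability : Pred (Pred Ω 0ℓ) (lsuc 0ℓ)
    WithPositiveProbability E = ∀ {F} → Measurable F → E ⊆ F → 0# < ℙ F

  Matrix : ℕ → ℕ → Set
  Matrix n d = Vector (Vector Carrier d) n

  infixr 8 _·_
  _·_ : ∀ {n d} → Matrix n d → Vector Carrier d → Vector Carrier n
  (A · x) i = sum (zipWith _*_ (A i) x)

  -- ‖ v ‖^ p is the p-th power of the ℓ_p norm of v.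
  ‖_‖^_ : ∀ {n} → Vector Carrier n → Carrier → Carrier
  ‖ v ‖^ p = sum (map (λ x → ∣ x ∣ ^ p) v)

  record Lip₁ : Set where
    field
      fun       : Carrier → Carrier
      fun-zero  : fun 0# ≈ 0#
      lipschitz : ∀ x y → ∣ fun x - fun y ∣ ≤ ∣ x - y ∣

  loss : ∀ {n d} → Carrier → Matrix n d → Lip₁ → Vector Carrier n →
         Vector Carrier d → Carrier
  loss p A f b x = ‖ zipWith _-_ (map (Lip₁.fun f) (A · x)) b ‖^ p

  AttainsOPT : ∀ {n d} → Carrier → Matrix n d → Lip₁ → Vector Carrier n →
               Pred (Vector Carrier d) 0ℓ
  AttainsOPT p A f b x = ∀ y → loss p A f b x ≤ loss p A f b y

  -- The defining property of x*.
  IsReference : ∀ {n d} → Carrier → Matrix n d → Lip₁ → Vector Carrier n →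
                Pred (Vector Carrier d) 0ℓ
  IsReference p A f b x* =
    AttainsOPT p A f b x* ×
    (∀ y → AttainsOPT p A f b y → ‖ A · x* ‖^ p ≤ ‖ A · y ‖^ p)

  -- A deterministic adaptive algorithm, as a decision tree querying the
  -- entries of a vector in ℝⁿ and returning a vector in ℝᵈ.
  data QueryTree (n d : ℕ) : Set where
    output : Vector Carrier d → QueryTree n d
    query  : Fin n → (Carrier → QueryTree n d) → QueryTree n d

  result : ∀ {n d} → QueryTree n d → Vector Carrier n → Vector Carrier d
  result (output x)  b = x
  result (query i k) b = result (k (b i)) b

  queryCount : ∀ {n d} → QueryTree n d → Vector Carrier n → ℕ
  queryCount (output x)  b = zero
  queryCount (query i k) b = suc (queryCount (k (b i)) b)

  record RandomizedAlgorithm (n d : ℕ) : Set₂ where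
    field
      space : ProbabilitySpace
    open ProbabilitySpace space public
    field
      tree : Matrix n d → Lip₁ → Ω → QueryTree n d

  -- An input for which the minimum OPT is not attained has no reference x*,
  -- and nothing is required of the algorithm on it.
  Succeeds : ∀ {n d} → Carrier → Carrier → RandomizedAlgorithm n d → Set₁
  Succeeds p ε alg =
    ∀ A f b x* → IsReference p A f b x* →
    let OPT = loss p A f b x* in
    WithProbabilityAtLeast (fromℕ 4 / fromℕ 5) λ ω →
      loss p A f b (result (tree A f ω) b) ≤ OPT + ε * (OPT + ‖ A · x* ‖^ p)
    where open RandomizedAlgorithm alg

{-# OPTIONS --safe #-}
-- The rows of A form d blocks; in block j there are h rows with the single entry 1 and h rows
-- with the single entry −1, both in column j.  Take f(t) = min(max(t, 0), ε), let b be ε on all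
-- these rows, and in each block raise b by a constant μ at one hidden row.  A coordinate x_j
-- can fit only one sign class, so the optimum takes the sign of the hidden row, and the opposite
-- sign costs (μ + ε)^p − μ^p − ε^p ≳ ε μ^p / μ more.  With h ≈ μ^p / ε^p each block has
-- OPT ≤ 2 μ^p, so for μ small an ε-accurate answer has the right sign in 7/8 of the blocks.
-- Conversely, if the signs found for two hidden rows of opposite sign are both right, one of the
-- two runs must read the hidden row of the other, so averaging over all inputs shows that a
-- deterministic algorithm with at most d h / 8 queries gets on average at most 5/8 of the signs.
-- Hence it is accurate on at most 5/7 < 4/5 of the inputs, and the probability space has a point
-- at which the randomized algorithm is accurate on more.
--
-- All bases that matter lie in [0, 1], so of real powers only monotonicity, x^p ≤ x² and
-- x^p y ≤ (x y)^p for y ≥ 1 are needed, and these can be read off the cut defining x^p.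
module Submission where

open import Defs
open import Axiom.ExcludedMiddle using (ExcludedMiddle)
open import Algebra.Bundles using (CommutativeRing)
import Algebra.Construct.NaturalChoice.Max as Max
import Algebra.Construct.NaturalChoice.Min as Min
open import Data.Bool.Base using (Bool; true; false; not; if_then_else_)
import Data.Bool.Properties as Bool
open import Data.Empty using (⊥-elim)
open import Data.Fin.Base using (Fin; zero; suc; splitAt; toℕ)
import Data.Fin.Properties as Fin
open import Data.List.Base as List using (List; []; _∷_; length; allFin; cartesianProduct; cartesianProductWith)
open import Data.Maybe.Base as Maybe using (Maybe; just; nothing)
import Data.Maybe.Properties as Maybe
open import Data.Nat.Base as ℕ using (ℕ; zero; suc; NonZero)
import Data.Nat.Properties as ℕ
open import Data.Product.Base using (∃-syntax; _×_; _,_; proj₁; proj₂; map₁)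
open import Data.Product.Properties using (≡-dec)
open import Data.Sum.Base as Sum using (_⊎_; inj₁; inj₂; [_,_])
open import Data.Vec.Base as Vec using (Vec; lookup; _[_]≔_)
open import Data.Vec.Functional using (Vector)
open import Function.Base using (_∘_)
open import Level using (0ℓ)
open import Relation.Binary.Bundles using (TotalOrder)
open import Relation.Binary.Definitions using (DecidableEquality)
open import Relation.Binary.PropositionalEquality as ≡ using (_≡_; _≢_)
open import Relation.Nullary using (¬_; Dec; yes; no; does; contradiction)
open import Relation.Nullary.Decidable using (dec-true; dec-false; decidable-stable)
open import Relation.Unary using (Pred; Satisfiable; U; ∅; ∁; ⋃; _⊆_; _≐_; _∪_; _∩_)

-- Finite sums of naturals and the averaging argument over all inputs

module Counting where

  open import Algebra.Properties.CommutativeSemigroup ℕ.+-commutativeSemigroup using (interchange)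
  open import Data.List.Base using (_++_)
  open import Data.List.Properties using (length-tabulate)
  open import Data.List.Relation.Unary.All using (All; []; _∷_)
  open import Data.List.Relation.Unary.AllPairs using ([]; _∷_)
  open import Data.List.Relation.Unary.Unique.Propositional using (Unique)
  open import Data.List.Relation.Unary.Unique.Propositional.Properties using (cartesianProduct⁺; allFin⁺)
  open import Data.Nat.Base
  open import Data.Nat.Properties
  open import Data.Nat.Solver using (module +-*-Solver)
  open import Function.Base using (id)
  open import Relation.Binary.PropositionalEquality hiding (J)

  private
    variable
      A B C : Set

  ∑ : List A → (A → ℕ) → ℕ
  ∑ []       f = 0
  ∑ (x ∷ xs) f = f x + ∑ xs f

  ∑-mono : ∀ xs {f g : A → ℕ} → (∀ x → f x ≤ g x) → ∑ xs f ≤ ∑ xs g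
  ∑-mono []       f≤g = z≤n
  ∑-mono (x ∷ xs) f≤g = +-mono-≤ (f≤g x) (∑-mono xs f≤g)

  ∑-cong : ∀ xs {f g : A → ℕ} → (∀ x → f x ≡ g x) → ∑ xs f ≡ ∑ xs g
  ∑-cong []       f≡g = refl
  ∑-cong (x ∷ xs) f≡g = cong₂ _+_ (f≡g x) (∑-cong xs f≡g)

  ∑-+ : ∀ xs (f g : A → ℕ) → ∑ xs (λ x → f x + g x) ≡ ∑ xs f + ∑ xs g
  ∑-+ []       f g = refl
  ∑-+ (x ∷ xs) f g = trans (cong (f x + g x +_) (∑-+ xs f g)) (interchange (f x) (g x) _ _)

  ∑-*ˡ : ∀ c xs (f : A → ℕ) → ∑ xs (λ x → c * f x) ≡ c * ∑ xs f
  ∑-*ˡ c []       f = sym (*-zeroʳ c)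
  ∑-*ˡ c (x ∷ xs) f = trans (cong (c * f x +_) (∑-*ˡ c xs f)) (sym (*-distribˡ-+ c (f x) _))

  ∑-const : ∀ (xs : List A) c → ∑ xs (λ _ → c) ≡ length xs * c
  ∑-const []       c = refl
  ∑-const (x ∷ xs) c = cong (c +_) (∑-const xs c)

  ∑-swap : ∀ xs ys (f : A → B → ℕ) → ∑ xs (λ x → ∑ ys (f x)) ≡ ∑ ys (λ y → ∑ xs (λ x → f x y))
  ∑-swap []       ys f = sym (trans (∑-const ys 0) (*-zeroʳ (length ys)))
  ∑-swap (x ∷ xs) ys f = trans (cong (∑ ys (f x) +_) (∑-swap xs ys f))
    (sym (∑-+ ys (f x) (λ y → ∑ xs (λ x → f x y))))

  ∑-++ : ∀ xs ys (f : A → ℕ) → ∑ (xs ++ ys) f ≡ ∑ xs f + ∑ ys f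
  ∑-++ []       ys f = refl
  ∑-++ (x ∷ xs) ys f = trans (cong (f x +_) (∑-++ xs ys f)) (sym (+-assoc (f x) _ _))

  ∑-map : ∀ (g : A → B) xs (f : B → ℕ) → ∑ (List.map g xs) f ≡ ∑ xs (λ x → f (g x))
  ∑-map g []       f = refl
  ∑-map g (x ∷ xs) f = cong (f (g x) +_) (∑-map g xs f)

  ∑-cartesianProductWith : ∀ (g : A → B → C) xs ys (f : C → ℕ) →
    ∑ (cartesianProductWith g xs ys) f ≡ ∑ xs (λ x → ∑ ys (λ y → f (g x y)))
  ∑-cartesianProductWith g []       ys f = refl
  ∑-cartesianProductWith g (x ∷ xs) ys f = trans (∑-++ (List.map (g x) ys) _ f)
    (cong₂ _+_ (∑-map (g x) ys f) (∑-cartesianProductWith g xs ys f))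

  indicator : ∀ {P : Set} → Dec P → ℕ
  indicator P? = if does P? then 1 else 0

  indicator≤ : ∀ {P : Set} {n} (P? : Dec P) → (P → 1 ≤ n) → indicator P? ≤ n
  indicator≤ (yes p) f = f p
  indicator≤ (no _)  f = z≤n

  indicator-yes : ∀ {P : Set} (P? : Dec P) → P → indicator P? ≡ 1
  indicator-yes (yes _) p = refl
  indicator-yes (no ¬p) p = ⊥-elim (¬p p)

  indicator-no : ∀ {P : Set} (P? : Dec P) → ¬ P → indicator P? ≡ 0
  indicator-no (yes p) ¬p = ⊥-elim (¬p p)
  indicator-no (no _)  ¬p = refl

  indicator≤1 : ∀ {P : Set} (P? : Dec P) → indicator P? ≤ 1
  indicator≤1 P? = indicator≤ P? λ _ → ≤-refl

  ∑-indicator-unique : ∀ {A : Set} (_≟_ : DecidableEquality A) {xs} → Unique xs →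
    ∀ y → ∑ xs (λ x → indicator (y ≟ x)) ≤ 1
  ∑-indicator-unique _≟_ []                      y = z≤n
  ∑-indicator-unique _≟_ {x ∷ xs} (x∉xs ∷ uniq) y with y ≟ x
  ... | no _     = ∑-indicator-unique _≟_ uniq y
  ... | yes refl = s≤s (≤-reflexive (absent xs x∉xs))
    where
    absent : ∀ xs → All (x ≢_) xs → ∑ xs (λ x′ → indicator (x ≟ x′)) ≡ 0
    absent []        []          = refl
    absent (x′ ∷ xs) (x≢ ∷ x≢xs) = cong₂ _+_ (indicator-no (x ≟ x′) x≢) (absent xs x≢xs)

  -- A position inside a block: the Boolean is the sign of the row's nonzero entry (`true` for 1,
  -- `false` for -1), the `Fin h` its index among the rows of that sign.
  Slot : ℕ → Set
  Slot h = Bool × Fin h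

  _≟ˢ_ : ∀ {h} → DecidableEquality (Slot h)
  _≟ˢ_ = ≡-dec Bool._≟_ Fin._≟_

  slots : ∀ h → List (Slot h)
  slots h = cartesianProduct (true ∷ false ∷ []) (allFin h)

  slots-unique : ∀ h → Unique (slots h)
  slots-unique h = cartesianProduct⁺ {xs = true ∷ false ∷ []} (((λ ()) ∷ []) ∷ [] ∷ []) (allFin⁺ h)

  ∑-slots : ∀ h (f : Slot h → ℕ) →
    ∑ (slots h) f ≡ ∑ (allFin h) (λ k → f (true , k)) + ∑ (allFin h) (λ k → f (false , k))
  ∑-slots h f = trans (∑-cartesianProductWith _,_ (true ∷ false ∷ []) (allFin h) f)
    (cong (∑ (allFin h) (λ k → f (true , k)) +_) (+-identityʳ _))

  ∑-allFin-const : ∀ h c → ∑ (allFin h) (λ _ → c) ≡ h * c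
  ∑-allFin-const h c = trans (∑-const (allFin h) c) (cong (_* c) (length-tabulate {n = h} id))

  ∑-slots-const : ∀ h c → ∑ (slots h) (λ _ → c) ≡ 2 * h * c
  ∑-slots-const h c = trans (∑-slots h (λ _ → c)) (trans (cong₂ _+_ (∑-allFin-const h c) (∑-allFin-const h c))
    (solve 2 (λ h c → h :* c :+ h :* c := con 2 :* h :* c) refl h c))
    where open +-*-Solver

  inputs : ∀ d h → List (Vec (Slot h) d)
  inputs zero    h = Vec.[] ∷ []
  inputs (suc d) h = cartesianProductWith Vec._∷_ (slots h) (inputs d h)

  inputs-nonempty : ∀ d h → .{{NonZero h}} → 1 ≤ length (inputs d h)
  inputs-nonempty d h = subst (1 ≤_) (trans (∑-const (inputs d h) 1) (*-identityʳ _)) (go d)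
    where
    go : ∀ d → 1 ≤ ∑ (inputs d h) (λ _ → 1)
    go zero    = s≤s z≤n
    go (suc d) = subst (1 ≤_)
      (sym (trans (∑-cartesianProductWith Vec._∷_ (slots h) (inputs d h) (λ _ → 1)) (∑-slots-const h _)))
      (*-mono-≤ (*-mono-≤ {1} {2} (s≤s z≤n) (>-nonZero⁻¹ h)) (go d))

  -- Resampling one coordinate preserves the uniform distribution: every vector arises from exactly
  -- `2 * h` pairs of a vector and a new slot for block `j`.
  ∑-resample : ∀ {d} h (j : Fin d) (f : Vec (Slot h) d → ℕ) →
    ∑ (inputs d h) (λ z → ∑ (slots h) λ t → f (z [ j ]≔ t)) ≡ 2 * h * ∑ (inputs d h) f
  ∑-resample {suc d} h zero f = begin
    ∑ (inputs (suc d) h) (λ z → ∑ (slots h) λ t → f (z [ zero ]≔ t))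
      ≡⟨ ∑-cartesianProductWith Vec._∷_ (slots h) (inputs d h) _ ⟩
    ∑ (slots h) (λ _ → ∑ (inputs d h) λ z → ∑ (slots h) λ t → f (t Vec.∷ z))
      ≡⟨ ∑-slots-const h _ ⟩
    2 * h * ∑ (inputs d h) (λ z → ∑ (slots h) λ t → f (t Vec.∷ z))
      ≡⟨ cong (2 * h *_) (∑-swap (inputs d h) (slots h) _) ⟩
    2 * h * ∑ (slots h) (λ t → ∑ (inputs d h) λ z → f (t Vec.∷ z))
      ≡⟨ cong (2 * h *_) (∑-cartesianProductWith Vec._∷_ (slots h) (inputs d h) f) ⟨
    2 * h * ∑ (inputs (suc d) h) f ∎
    where open ≡-Reasoning
  ∑-resample {suc d} h (suc j) f = begin
    ∑ (inputs (suc d) h) (λ z → ∑ (slots h) λ t → f (z [ suc j ]≔ t))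
      ≡⟨ ∑-cartesianProductWith Vec._∷_ (slots h) (inputs d h) _ ⟩
    ∑ (slots h) (λ s → ∑ (inputs d h) λ z → ∑ (slots h) λ t → f (s Vec.∷ (z [ j ]≔ t)))
      ≡⟨ ∑-cong (slots h) (λ s → ∑-resample h j (λ z → f (s Vec.∷ z))) ⟩
    ∑ (slots h) (λ s → 2 * h * ∑ (inputs d h) λ z → f (s Vec.∷ z))
      ≡⟨ ∑-*ˡ (2 * h) (slots h) _ ⟩
    2 * h * ∑ (slots h) (λ s → ∑ (inputs d h) λ z → f (s Vec.∷ z))
      ≡⟨ cong (2 * h *_) (∑-cartesianProductWith Vec._∷_ (slots h) (inputs d h) f) ⟨
    2 * h * ∑ (inputs (suc d) h) f ∎
    where open ≡-Reasoning

  -- Sum the hypothesis over all `h * h` pairs of slots of opposite sign. Each value of `a` then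
  -- occurs `h` times, and the terms of `v` on the right are part of the sum over all ordered pairs
  -- of slots.
  ∑-opposite : ∀ h (a : Slot h → ℕ) (v : Slot h → Slot h → ℕ) →
    (∀ k k′ → a (true , k) + a (false , k′) ≤ 1 + (v (true , k) (false , k′) + v (false , k′) (true , k))) →
    h * ∑ (slots h) a ≤ h * h + ∑ (slots h) (λ t → ∑ (slots h) (v t))
  ∑-opposite h a v pair = begin
    h * ∑ (slots h) a
      ≡⟨ trans (cong (h *_) (∑-slots h a)) (*-distribˡ-+ h _ _) ⟩
    h * ∑ F (λ k → a (true , k)) + h * ∑ F (λ k → a (false , k))
      ≡⟨ cong₂ _+_ (trans (sym (∑-*ˡ h F _)) (∑-cong F λ k → sym (∑-allFin-const h _))) (sym (∑-allFin-const h _)) ⟩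
    ∑ F (λ k → ∑ F λ k′ → a (true , k)) + ∑ F (λ k → ∑ F λ k′ → a (false , k′))
      ≡⟨ trans (sym (∑-+ F _ _)) (∑-cong F λ k → sym (∑-+ F _ _)) ⟩
    ∑ F (λ k → ∑ F λ k′ → a (true , k) + a (false , k′))
      ≤⟨ ∑-mono F (λ k → ∑-mono F (pair k)) ⟩
    ∑ F (λ k → ∑ F λ k′ → 1 + (v (true , k) (false , k′) + v (false , k′) (true , k)))
      ≡⟨ trans (∑-cong F λ k → trans (∑-+ F _ _) (cong (∑ F (λ _ → 1) +_) (∑-+ F _ _)))
           (trans (∑-+ F _ _) (cong (∑ F (λ _ → ∑ F λ _ → 1) +_) (∑-+ F _ _))) ⟩
    ∑ F (λ _ → ∑ F λ _ → 1) + (∑ F (λ k → ∑ F λ k′ → v (true , k) (false , k′)) + ∑ F (λ k → ∑ F λ k′ → v (false , k′) (true , k)))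
      ≤⟨ +-mono-≤ (≤-reflexive (trans (∑-allFin-const h _) (cong (h *_) (trans (∑-allFin-const h 1) (*-identityʳ h)))))
           (+-mono-≤ (∑-mono F λ k → ≤-trans (m≤n+m _ _) (≤-reflexive (sym (∑-slots h (v (true , k))))))
             (≤-trans (≤-reflexive (∑-swap F F _))
               (∑-mono F λ k → ≤-trans (m≤m+n _ _) (≤-reflexive (sym (∑-slots h (v (false , k)))))))) ⟩
    h * h + (∑ F (λ k → ∑ (slots h) (v (true , k))) + ∑ F (λ k → ∑ (slots h) (v (false , k))))
      ≡⟨ cong (h * h +_) (∑-slots h _) ⟨
    h * h + ∑ (slots h) (λ t → ∑ (slots h) (v t)) ∎
    where
    open ≤-Reasoning
    F = allFin h

  -- In the application `a z j` scores a correct sign in block `j` on input `z`, and `v z j t`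
  -- counts the reads of slot `t` of that block. `pair` is the exchange argument between two hidden
  -- rows of opposite sign, `few` the query budget.
  module _ (d h : ℕ) .{{_ : NonZero h}}
    (a : Vec (Slot h) d → Fin d → ℕ) (v : Vec (Slot h) d → Fin d → Slot h → ℕ)
    (pair : ∀ z j k k′ → a (z [ j ]≔ (true , k)) j + a (z [ j ]≔ (false , k′)) j
      ≤ 1 + (v (z [ j ]≔ (true , k)) j (false , k′) + v (z [ j ]≔ (false , k′)) j (true , k)))
    (few : ∀ z → 8 * ∑ (allFin d) (λ j → ∑ (slots h) (v z j)) ≤ d * h)
    where

    private
      J = allFin d
      Z = inputs d h
      N G V : ℕ
      N = length Z
      G = ∑ Z λ z → ∑ J (a z)
      V = ∑ Z λ z → ∑ J λ j → ∑ (slots h) (v z j)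

    -- Resample the hidden slot of block `j`, apply `∑-opposite` to the new slot, and undo the
    -- resampling in the `v` term. The factor `h` comes from `∑-opposite`, the factor `2 * h` from
    -- `∑-resample`.
    ∑-block : ∀ j → h * (2 * h * ∑ Z (λ z → a z j)) ≤ N * (h * h) + 2 * h * ∑ Z (λ z → ∑ (slots h) (v z j))
    ∑-block j = begin
      h * (2 * h * ∑ Z (λ z → a z j))
        ≡⟨ cong (h *_) (∑-resample h j (λ z → a z j)) ⟨
      h * ∑ Z (λ z → ∑ (slots h) λ t → a (z [ j ]≔ t) j)
        ≡⟨ ∑-*ˡ h Z _ ⟨
      ∑ Z (λ z → h * ∑ (slots h) λ t → a (z [ j ]≔ t) j)
        ≤⟨ ∑-mono Z (λ z → ∑-opposite h _ (λ t → v (z [ j ]≔ t) j) (pair z j)) ⟩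
      ∑ Z (λ z → h * h + ∑ (slots h) λ t → ∑ (slots h) (v (z [ j ]≔ t) j))
        ≡⟨ ∑-+ Z _ _ ⟩
      ∑ Z (λ _ → h * h) + ∑ Z (λ z → ∑ (slots h) λ t → ∑ (slots h) (v (z [ j ]≔ t) j))
        ≡⟨ cong₂ _+_ (∑-const Z (h * h)) (∑-resample h j (λ z → ∑ (slots h) (v z j))) ⟩
      N * (h * h) + 2 * h * ∑ Z (λ z → ∑ (slots h) (v z j)) ∎
      where open ≤-Reasoning

    ∑-blocks : h * (2 * h * G) ≤ d * (N * (h * h)) + 2 * h * V
    ∑-blocks = begin
      h * (2 * h * G)
        ≡⟨ cong (λ g → h * (2 * h * g)) (∑-swap Z J a) ⟩
      h * (2 * h * ∑ J (λ j → ∑ Z λ z → a z j))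
        ≡⟨ trans (∑-*ˡ h J _) (cong (h *_) (∑-*ˡ (2 * h) J _)) ⟨
      ∑ J (λ j → h * (2 * h * ∑ Z λ z → a z j))
        ≤⟨ ∑-mono J ∑-block ⟩
      ∑ J (λ j → N * (h * h) + 2 * h * ∑ Z (λ z → ∑ (slots h) (v z j)))
        ≡⟨ ∑-+ J _ _ ⟩
      ∑ J (λ _ → N * (h * h)) + ∑ J (λ j → 2 * h * ∑ Z (λ z → ∑ (slots h) (v z j)))
        ≡⟨ cong₂ _+_ (∑-allFin-const d _) (trans (∑-*ˡ (2 * h) J _)
             (cong (2 * h *_) (sym (∑-swap Z J (λ z j → ∑ (slots h) (v z j)))))) ⟩
      d * (N * (h * h)) + 2 * h * V ∎
      where open ≤-Reasoning

    8V≤ : 8 * V ≤ N * (d * h)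
    8V≤ = begin
      8 * V                                                            ≡⟨ ∑-*ˡ 8 Z _ ⟨
      ∑ Z (λ z → 8 * ∑ J (λ j → ∑ (slots h) (v z j)))                  ≤⟨ ∑-mono Z few ⟩
      ∑ Z (λ z → d * h)                                                ≡⟨ ∑-const Z (d * h) ⟩
      N * (d * h)                                                      ∎
      where open ≤-Reasoning

    -- Up to the factor `2 * (h * h)`, `∑-blocks` reads G ≤ dN/2 + V/h, and the budget gives V/h ≤
    -- dN/8. Guessing accounts for 1/2, the queries for 1/8.
    average≤5/8 : 8 * G ≤ 5 * (d * N)
    average≤5/8 = *-cancelˡ-≤ (2 * (h * h)) {{m*n≢0 2 (h * h) {{_}} {{m*n≢0 h h}}}} (begin
      2 * (h * h) * (8 * G)
        ≡⟨ solve 2 (λ h g → con 2 :* (h :* h) :* (con 8 :* g) := con 8 :* (h :* (con 2 :* h :* g))) refl h G ⟩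
      8 * (h * (2 * h * G))
        ≤⟨ *-monoʳ-≤ 8 ∑-blocks ⟩
      8 * (d * (N * (h * h)) + 2 * h * V)
        ≡⟨ solve 4 (λ d n h v → con 8 :* (d :* (n :* (h :* h)) :+ con 2 :* h :* v)
             := con 8 :* (d :* (n :* (h :* h))) :+ con 2 :* h :* (con 8 :* v)) refl d N h V ⟩
      8 * (d * (N * (h * h))) + 2 * h * (8 * V)
        ≤⟨ +-monoʳ-≤ _ (*-monoʳ-≤ (2 * h) 8V≤) ⟩
      8 * (d * (N * (h * h))) + 2 * h * (N * (d * h))
        ≡⟨ solve 3 (λ d n h → con 8 :* (d :* (n :* (h :* h))) :+ con 2 :* h :* (n :* (d :* h))
             := con 2 :* (h :* h) :* (con 5 :* (d :* n))) refl d N h ⟩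
      2 * (h * h) * (5 * (d * N)) ∎)
      where
      open ≤-Reasoning
      open +-*-Solver

  -- There are `d` blocks of `2 * h` rows and then `r` padding rows. The recursion by blocks lets
  -- `label` peel off `h` rows at a time with `splitAt`, without transport along an equation.
  rows : ℕ → ℕ → ℕ → ℕ
  rows r h zero    = r
  rows r h (suc d) = h + (h + rows r h d)

  rows≡ : ∀ r h d → d * (2 * h) + r ≡ rows r h d
  rows≡ r h zero    = refl
  rows≡ r h (suc d) = trans
    (solve 3 (λ x h r → ((h :+ (h :+ con 0)) :+ x) :+ r := h :+ (h :+ (x :+ r))) refl (d * (2 * h)) h r)
    (cong (λ m → h + (h + m)) (rows≡ r h d))
    where open +-*-Solver

-- Decision trees on inputs with one hidden row per block

module Queries (em : ∀ {ℓ} → ExcludedMiddle ℓ) (ℝ : CompleteOrderedField) where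

  open import Data.List.Relation.Unary.Unique.Propositional.Properties using (cartesianProduct⁺; allFin⁺)
  open import Data.Nat.Base
  open import Data.Nat.Properties
  open import Data.Vec.Properties using (lookup∘update; lookup∘update′)
  open import Relation.Binary.PropositionalEquality
  open Counting
  open Reals ℝ using (Carrier; 0#; QueryTree; output; query; result; queryCount)

  -- The block and slot of a row; a padding row has `nothing` as its value in `Maybe (Label d h)`.
  Label : ℕ → ℕ → Set
  Label d h = Fin d × Slot h

  _≟ᴸ_ : ∀ {d h} → DecidableEquality (Label d h)
  _≟ᴸ_ = ≡-dec Fin._≟_ _≟ˢ_

  module _ {n d h : ℕ} (label : Fin n → Maybe (Label d h)) where

    visits : QueryTree n d → Vector Carrier n → Label d h → ℕ
    visits (output x)  b l = 0
    visits (query i k) b l = indicator (Maybe.≡-dec _≟ᴸ_ (label i) (just l)) + visits (k (b i)) b l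

    -- The double sum runs over pairwise distinct labels, so one query is charged to at most one
    -- slot. This is why the visits add up to at most the number of queries.
    ∑-indicator-label : ∀ i →
      ∑ (allFin d) (λ j → ∑ (slots h) λ t → indicator (Maybe.≡-dec _≟ᴸ_ (label i) (just (j , t)))) ≤ 1
    ∑-indicator-label i with label i
    ... | nothing = ≤-trans (≤-reflexive (trans (∑-cong (allFin d) λ j → ∑-slots-const h 0)
      (trans (∑-const (allFin d) _) (cong (length (allFin d) *_) (*-zeroʳ (2 * h))))))
      (≤-trans (≤-reflexive (*-zeroʳ (length (allFin d)))) z≤n)
    ... | just l  = ≤-trans (≤-reflexive (sym (∑-cartesianProductWith _,_ (allFin d) (slots h) _)))
      (≤-trans (∑-mono (cartesianProduct (allFin d) (slots h)) λ l′ → ≤-reflexive refl)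
        (∑-indicator-unique _≟ᴸ_ (cartesianProduct⁺ (allFin⁺ d) (slots-unique h)) l))

    ∑-visits : ∀ T b → ∑ (allFin d) (λ j → ∑ (slots h) λ t → visits T b (j , t)) ≤ queryCount T b
    ∑-visits (output x)  b = ≤-reflexive (trans (∑-cong (allFin d) λ j → trans (∑-slots-const h 0) (*-zeroʳ (2 * h)))
      (trans (∑-const (allFin d) 0) (*-zeroʳ (length (allFin d)))))
    ∑-visits (query i k) b = ≤-trans
      (≤-reflexive (trans (∑-cong (allFin d) λ j → ∑-+ (slots h) _ _) (∑-+ (allFin d) _ _)))
      (+-mono-≤ (∑-indicator-label i) (∑-visits (k (b i)) b))

    -- Until one of the two runs reads a row labelled l or l′ they agree, and the first such row is
    -- read by both.
    diverge : ∀ T {b b′} l l′ → (∀ i → label i ≢ just l → label i ≢ just l′ → b i ≡ b′ i) →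
      result T b ≢ result T b′ → 1 ≤ visits T b l′ + visits T b′ l
    diverge (output x)  l l′ agree differ = ⊥-elim (differ refl)
    diverge (query i k) {b} {b′} l l′ agree differ
      with Maybe.≡-dec _≟ᴸ_ (label i) (just l) | Maybe.≡-dec _≟ᴸ_ (label i) (just l′)
    ... | yes _ | _     = ≤-trans (s≤s z≤n) (m≤n+m _ _)
    ... | no _  | yes _ = s≤s z≤n
    ... | no ≢l | no ≢l′ with agree i ≢l ≢l′
    ...   | eq = subst (λ y → 1 ≤ visits (k (b i)) b l′ + visits (k y) b′ l) eq
      (diverge (k (b i)) l l′ agree (subst (λ y → result (k (b i)) b ≢ result (k y) b′) (sym eq) differ))

  module _ (lo hi : Carrier) where

    entry : ∀ {d h} → Vec (Slot h) d → Maybe (Label d h) → Carrier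
    entry z nothing        = 0#
    entry z (just (j , t)) = if does (t ≟ˢ lookup z j) then hi else lo

    -- Supplies the agreement hypothesis of `diverge`: moving the hidden slot of block `j` from `t`
    -- to `t′` changes `b` only on rows with these two labels.
    entry-update : ∀ {d h} (z : Vec (Slot h) d) j t t′ (l : Maybe (Label d h)) →
      l ≢ just (j , t) → l ≢ just (j , t′) → entry (z [ j ]≔ t) l ≡ entry (z [ j ]≔ t′) l
    entry-update z j t t′ nothing         ≢t ≢t′ = refl
    entry-update z j t t′ (just (i , s)) ≢t ≢t′ with i Fin.≟ j
    ... | no i≢j rewrite lookup∘update′ i≢j z t | lookup∘update′ i≢j z t′ = refl
    ... | yes refl rewrite lookup∘update j z t | lookup∘update j z t′
                         | dec-false (s ≟ˢ t) (λ { refl → ≢t refl })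
                         | dec-false (s ≟ˢ t′) (λ { refl → ≢t′ refl }) = refl

  module _ {n d h : ℕ} .{{_ : NonZero d}} .{{_ : NonZero h}} (label : Fin n → Maybe (Label d h))
    (lo hi : Carrier) (guess : Carrier → Bool) (T : QueryTree n d) (Good : Vec (Slot h) d → Set) where

    private
      b : Vec (Slot h) d → Vector Carrier n
      b z i = entry lo hi z (label i)

      good : Vec (Slot h) d → ℕ
      good z = indicator (em {P = Good z})

    guessed : Vec (Slot h) d → Fin d → ℕ
    guessed z j = indicator (guess (result T (b z) j) Bool.≟ proj₁ (lookup z j))

    private
      guessed≤1 : ∀ z j → guessed z j ≤ 1
      guessed≤1 z j = indicator≤1 (guess (result T (b z) j) Bool.≟ proj₁ (lookup z j))

    -- A good input scores at least 7/8 of its blocks, while the average score is at most 5/8 of the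
    -- blocks, so at most 5/7 of the inputs are good.
    few-good : (∀ z → Good z → 8 * queryCount T (b z) ≤ d * h) →
               (∀ z → Good z → 7 * d ≤ 8 * ∑ (allFin d) (guessed z)) →
               7 * ∑ (inputs d h) good ≤ 5 * length (inputs d h)
    few-good few correct = *-cancelˡ-≤ d (begin
      d * (7 * ∑ Z good)
        ≡⟨ trans (sym (*-assoc d 7 _)) (trans (cong (_* ∑ Z good) (*-comm d 7)) (sym (∑-*ˡ (7 * d) Z good))) ⟩
      ∑ Z (λ z → 7 * d * good z)
        ≤⟨ ∑-mono Z score ⟩
      ∑ Z (λ z → 8 * ∑ (allFin d) (a z))
        ≡⟨ ∑-*ˡ 8 Z _ ⟩
      8 * ∑ Z (λ z → ∑ (allFin d) (a z))
        ≤⟨ average≤5/8 d h a v pair v-few ⟩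
      5 * (d * length Z)
        ≡⟨ trans (sym (*-assoc 5 d _)) (trans (cong (_* length Z) (*-comm 5 d)) (*-assoc d 5 _)) ⟩
      d * (5 * length Z) ∎)
      where
      open ≤-Reasoning
      Z = inputs d h

      -- Scores and visits are multiplied by `good z`: on inputs outside `Good`, where neither the
      -- budget nor correctness is known, both are zero.
      a : Vec (Slot h) d → Fin d → ℕ
      a z j = good z * guessed z j

      v : Vec (Slot h) d → Fin d → Slot h → ℕ
      v z j t = good z * visits label T (b z) (j , t)

      score : ∀ z → 7 * d * good z ≤ 8 * ∑ (allFin d) (a z)
      score z with em {P = Good z}
      ... | no _  = ≤-trans (≤-reflexive (*-zeroʳ (7 * d))) z≤n
      ... | yes g = ≤-trans (≤-reflexive (*-identityʳ (7 * d))) (≤-trans (correct z g)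
        (*-monoʳ-≤ 8 (∑-mono (allFin d) λ j → ≤-reflexive (sym (+-identityʳ _)))))

      v-few : ∀ z → 8 * ∑ (allFin d) (λ j → ∑ (slots h) (v z j)) ≤ d * h
      v-few z with em {P = Good z}
      ... | no _  = ≤-trans (≤-reflexive (cong (8 *_) (trans (∑-cong (allFin d) λ j → trans (∑-slots-const h 0) (*-zeroʳ (2 * h)))
        (trans (∑-const (allFin d) 0) (*-zeroʳ (length (allFin d))))))) z≤n
      ... | yes g = ≤-trans (*-monoʳ-≤ 8 (≤-trans
        (∑-mono (allFin d) λ j → ∑-mono (slots h) λ t → ≤-reflexive (+-identityʳ _)) (∑-visits label T (b z)))) (few z g)

      pair : ∀ z j k k′ → let t = true , k; t′ = false , k′ in
        a (z [ j ]≔ t) j + a (z [ j ]≔ t′) j ≤ 1 + (v (z [ j ]≔ t) j t′ + v (z [ j ]≔ t′) j t)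
      pair z j k k′ with em {P = Good (z [ j ]≔ (true , k))} | em {P = Good (z [ j ]≔ (false , k′))}
      ... | no _  | no _  = z≤n
      ... | no _  | yes _ = ≤-trans (≤-reflexive (+-identityʳ _)) (≤-trans (guessed≤1 (z [ j ]≔ (false , k′)) j) (s≤s z≤n))
      ... | yes _ | no _  = ≤-trans (≤-reflexive (trans (+-identityʳ _) (+-identityʳ _))) (≤-trans (guessed≤1 (z [ j ]≔ (true , k)) j) (s≤s z≤n))
      ... | yes _ | yes _ rewrite lookup∘update j z (true , k) | lookup∘update j z (false , k′)
        with guess (result T (b (z [ j ]≔ (true , k))) j) in eq | guess (result T (b (z [ j ]≔ (false , k′))) j) in eq′
      ...   | true  | true  = s≤s z≤n
      ...   | false | false = s≤s z≤n
      ...   | false | true  = z≤n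
      -- Both guesses are right, so the outputs differ in coordinate `j` and `diverge` provides the
      -- visit that pays for the second point. In all other cases the score is at most 1.
      ...   | true  | false = s≤s (≤-trans
        (diverge label T (j , true , k) (j , false , k′) (λ i → entry-update lo hi z j (true , k) (false , k′) (label i))
          λ same → contradiction (trans (sym eq) (trans (cong (λ x → guess (x j)) same) eq′)) λ ())
        (≤-reflexive (sym (cong₂ _+_ (+-identityʳ (visits label T (b (z [ j ]≔ (true , k))) (j , false , k′)))
                                     (+-identityʳ (visits label T (b (z [ j ]≔ (false , k′))) (j , true , k)))))))

-- Arithmetic and order in a complete ordered field

module Field (em : ∀ {ℓ} → ExcludedMiddle ℓ) (ℝ : CompleteOrderedField) where

  open CompleteOrderedField ℝ public
  open CommutativeRing commutativeRing public
    using ( ring; +-abelianGroup; commutativeSemiring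
          ; +-cong; +-congˡ; +-congʳ; +-comm; +-assoc; +-identityˡ; +-identityʳ
          ; *-congˡ; *-congʳ; *-comm; *-assoc; *-identityˡ; *-identityʳ
          ; distribˡ; distribʳ; zeroˡ; zeroʳ; -‿cong; -‿inverseˡ; -‿inverseʳ )
    renaming (reflexive to ≈-reflexive; refl to ≈-refl; sym to ≈-sym; trans to ≈-trans)
  open TotalOrder totalOrder public
    using (poset; antisym; total)
    renaming ( refl to ≤-refl; reflexive to ≤-reflexive; trans to ≤-trans
             ; ≤-respˡ-≈ to ≤-respˡ; ≤-respʳ-≈ to ≤-respʳ )
  open Min totalOrder public using (_⊓_)
  module ⊓ = Min totalOrder
  module ⊔ = Max totalOrder
  open import Algebra.Properties.Ring ring public
    using (-‿distribˡ-*)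
    renaming (-‿involutive to neg-involutive)
  open import Algebra.Solver.Ring.NaturalCoefficients.Default commutativeSemiring public
    using (solve; _:=_; _:+_; _:*_; con)
  open import Algebra.Properties.Semiring.Mult semiring public
    using (×-homo-+; ×1-homo-*)
  open import Algebra.Properties.Semiring.Exp semiring public
    using (^-assocʳ; ^-congˡ)
  open import Algebra.Properties.CommutativeSemiring.Exp commutativeSemiring public
    using (^-distrib-*)
  open import Relation.Binary.Reasoning.PartialOrder poset public
    using (begin_; step-≤; step-≈-⟩; step-≈-⟨; _∎)

  <⇒≤ : ∀ {x y} → x < y → x ≤ y
  <⇒≤ {x} {y} x<y with total x y
  ... | inj₁ x≤y = x≤y
  ... | inj₂ y≤x = ⊥-elim (x<y y≤x)

  <-≤-trans : ∀ {x y z} → x < y → y ≤ z → x < z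
  <-≤-trans x<y y≤z z≤x = x<y (≤-trans y≤z z≤x)

  ≤-<-trans : ∀ {x y z} → x ≤ y → y < z → x < z
  ≤-<-trans x≤y y<z z≤x = y<z (≤-trans z≤x x≤y)

  0<⇒≉0 : ∀ {x} → 0# < x → x ≉ 0#
  0<⇒≉0 0<x x≈0 = 0<x (≤-reflexive x≈0)

  +-monoˡ-≤ : ∀ z {x y} → x ≤ y → x + z ≤ y + z
  +-monoˡ-≤ z {x} {y} x≤y = begin
    x + z ≈⟨ +-comm x z ⟩
    z + x ≤⟨ +-monoʳ-≤ z x≤y ⟩
    z + y ≈⟨ +-comm z y ⟩
    y + z ∎

  +-mono-≤ : ∀ {x y u v} → x ≤ y → u ≤ v → x + u ≤ y + v
  +-mono-≤ {y = y} {u} x≤y u≤v = ≤-trans (+-monoˡ-≤ u x≤y) (+-monoʳ-≤ y u≤v)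

  +-nonNeg : ∀ {x y} → 0# ≤ x → 0# ≤ y → 0# ≤ x + y
  +-nonNeg 0≤x 0≤y = ≤-respˡ (+-identityˡ 0#) (+-mono-≤ 0≤x 0≤y)

  x≤x+y : ∀ {x y} → 0# ≤ y → x ≤ x + y
  x≤x+y {x} 0≤y = ≤-respˡ (+-identityʳ x) (+-monoʳ-≤ x 0≤y)

  x≤y+x : ∀ {x y} → 0# ≤ y → x ≤ y + x
  x≤y+x {x} 0≤y = ≤-respˡ (+-identityˡ x) (+-monoˡ-≤ x 0≤y)

  -x+x+y≈y : ∀ x y → - x + (x + y) ≈ y
  -x+x+y≈y x y = ≈-trans (≈-sym (+-assoc (- x) x y))
    (≈-trans (+-congʳ (-‿inverseˡ x)) (+-identityˡ y))

  x+[y-x]≈y : ∀ x y → x + (y - x) ≈ y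
  x+[y-x]≈y x y = ≈-trans (+-congˡ (+-comm y (- x)))
    (≈-trans (≈-sym (+-assoc x (- x) y))
    (≈-trans (+-congʳ (-‿inverseʳ x)) (+-identityˡ y)))

  +-cancelˡ-≤ : ∀ z {x y} → z + x ≤ z + y → x ≤ y
  +-cancelˡ-≤ z {x} {y} le =
    ≤-respˡ (-x+x+y≈y z x) (≤-respʳ (-x+x+y≈y z y) (+-monoʳ-≤ (- z) le))

  x≤y⇒0≤y-x : ∀ {x y} → x ≤ y → 0# ≤ y - x
  x≤y⇒0≤y-x {x} {y} x≤y = ≤-respˡ (-‿inverseʳ x) (+-monoˡ-≤ (- x) x≤y)

  x≤0⇒0≤-x : ∀ {x} → x ≤ 0# → 0# ≤ - x
  x≤0⇒0≤-x {x} x≤0 = ≤-respʳ (+-identityˡ (- x)) (x≤y⇒0≤y-x x≤0)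

  0≤x⇒-x≤0 : ∀ {x} → 0# ≤ x → - x ≤ 0#
  0≤x⇒-x≤0 {x} 0≤x = ≤-respˡ (+-identityˡ (- x)) (≤-respʳ (-‿inverseʳ x) (+-monoˡ-≤ (- x) 0≤x))

  *-monoˡ-≤ : ∀ {z x y} → 0# ≤ z → x ≤ y → z * x ≤ z * y
  *-monoˡ-≤ {z} {x} {y} 0≤z x≤y = begin
    z * x               ≤⟨ x≤x+y (*-nonNeg 0≤z (x≤y⇒0≤y-x x≤y)) ⟩
    z * x + z * (y - x) ≈⟨ distribˡ z x (y - x) ⟨
    z * (x + (y - x))   ≈⟨ *-congˡ (x+[y-x]≈y x y) ⟩
    z * y               ∎

  *-monoʳ-≤ : ∀ {z x y} → 0# ≤ z → x ≤ y → x * z ≤ y * z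
  *-monoʳ-≤ {z} {x} {y} 0≤z x≤y = ≤-respˡ (*-comm z x) (≤-respʳ (*-comm z y) (*-monoˡ-≤ 0≤z x≤y))

  *-mono-≤ : ∀ {x y u v} → 0# ≤ u → 0# ≤ y → x ≤ y → u ≤ v → x * u ≤ y * v
  *-mono-≤ 0≤u 0≤y x≤y u≤v = ≤-trans (*-monoʳ-≤ 0≤u x≤y) (*-monoˡ-≤ 0≤y u≤v)

  0≤1 : 0# ≤ 1#
  0≤1 with total 0# 1#
  ... | inj₁ 0≤1 = 0≤1
  ... | inj₂ 1≤0 = ≤-respʳ
    (≈-trans (≈-sym (-‿distribˡ-* 1# (- 1#)))
    (≈-trans (-‿cong (*-identityˡ (- 1#))) (neg-involutive 1#)))
    (*-nonNeg (x≤0⇒0≤-x 1≤0) (x≤0⇒0≤-x 1≤0))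

  0<1 : 0# < 1#
  0<1 1≤0 = 0≉1 (antisym 0≤1 1≤0)

  ⁻¹-inverseˡ : ∀ {x} → x ≉ 0# → x ⁻¹ * x ≈ 1#
  ⁻¹-inverseˡ {x} x≉0 = ≈-trans (*-comm (x ⁻¹) x) (⁻¹-inverseʳ x≉0)

  *-cancelˡ : ∀ {z x y} → z ≉ 0# → z * x ≈ z * y → x ≈ y
  *-cancelˡ {z} {x} {y} z≉0 eq = ≈-trans (≈-sym (undo x)) (≈-trans (*-congˡ eq) (undo y))
    where
    undo : ∀ u → z ⁻¹ * (z * u) ≈ u
    undo u = ≈-trans (≈-sym (*-assoc (z ⁻¹) z u))
      (≈-trans (*-congʳ (⁻¹-inverseˡ z≉0)) (*-identityˡ u))

  *-cancelˡ-≤ : ∀ {z x y} → 0# < z → z * x ≤ z * y → x ≤ y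
  *-cancelˡ-≤ {z} {x} {y} 0<z le with total x y
  ... | inj₁ x≤y = x≤y
  ... | inj₂ y≤x = ≤-reflexive
    (*-cancelˡ (0<⇒≉0 0<z) (antisym le (*-monoˡ-≤ (<⇒≤ 0<z) y≤x)))

  *-pos : ∀ {x y} → 0# < x → 0# < y → 0# < x * y
  *-pos {x} {y} 0<x 0<y xy≤0 = 0<y (*-cancelˡ-≤ 0<x (≤-respʳ (≈-sym (zeroʳ x)) xy≤0))

  ⁻¹-pos : ∀ {x} → 0# < x → 0# < x ⁻¹
  ⁻¹-pos {x} 0<x x⁻¹≤0 = 0<1 (begin
    1#       ≈⟨ ⁻¹-inverseʳ (0<⇒≉0 0<x) ⟨
    x * x ⁻¹ ≤⟨ *-monoˡ-≤ (<⇒≤ 0<x) x⁻¹≤0 ⟩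
    x * 0#   ≈⟨ zeroʳ x ⟩
    0#       ∎)

  /-cancel : ∀ {x y} → 0# < y → y * (x / y) ≈ x
  /-cancel {x} {y} 0<y = ≈-trans (solve 3 (λ a b c → a :* (b :* c) := b :* (a :* c)) ≈-refl y x (y ⁻¹))
    (≈-trans (*-congˡ (⁻¹-inverseʳ (0<⇒≉0 0<y))) (*-identityʳ x))

  fromℕ-nonNeg : ∀ n → 0# ≤ fromℕ n
  fromℕ-nonNeg zero    = ≤-refl
  fromℕ-nonNeg (suc n) = +-nonNeg 0≤1 (fromℕ-nonNeg n)

  fromℕ-+ : ∀ m n → fromℕ (m ℕ.+ n) ≈ fromℕ m + fromℕ n
  fromℕ-+ = ×-homo-+ 1#

  fromℕ-* : ∀ m n → fromℕ (m ℕ.* n) ≈ fromℕ m * fromℕ n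
  fromℕ-* = ×1-homo-*

  fromℕ-mono : ∀ {m n} → m ℕ.≤ n → fromℕ m ≤ fromℕ n
  fromℕ-mono (ℕ.z≤n {n})  = fromℕ-nonNeg n
  fromℕ-mono (ℕ.s≤s m≤n) = +-monoʳ-≤ 1# (fromℕ-mono m≤n)

  fromℕ-pos : ∀ {n} → 1 ℕ.≤ n → 0# < fromℕ n
  fromℕ-pos 1≤n = <-≤-trans 0<1 (≤-respˡ (+-identityʳ 1#) (fromℕ-mono 1≤n))

  fromℕ-cancel-≤ : ∀ m n → fromℕ m ≤ fromℕ n → m ℕ.≤ n
  fromℕ-cancel-≤ zero    n       le = ℕ.z≤n
  fromℕ-cancel-≤ (suc m) zero    le = ⊥-elim (fromℕ-pos {suc m} (ℕ.s≤s ℕ.z≤n) le)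
  fromℕ-cancel-≤ (suc m) (suc n) le = ℕ.s≤s (fromℕ-cancel-≤ m n (+-cancelˡ-≤ 1# le))

  ^ⁿ-nonNeg : ∀ {x} n → 0# ≤ x → 0# ≤ x ^ⁿ n
  ^ⁿ-nonNeg zero    0≤x = 0≤1
  ^ⁿ-nonNeg (suc n) 0≤x = *-nonNeg 0≤x (^ⁿ-nonNeg n 0≤x)

  ^ⁿ-pos : ∀ {x} n → 0# < x → 0# < x ^ⁿ n
  ^ⁿ-pos zero    0<x = 0<1
  ^ⁿ-pos (suc n) 0<x = *-pos 0<x (^ⁿ-pos n 0<x)

  ^ⁿ-mono-≤ : ∀ {x y} n → 0# ≤ x → x ≤ y → x ^ⁿ n ≤ y ^ⁿ n
  ^ⁿ-mono-≤ zero    0≤x x≤y = ≤-refl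
  ^ⁿ-mono-≤ (suc n) 0≤x x≤y =
    *-mono-≤ (^ⁿ-nonNeg n 0≤x) (≤-trans 0≤x x≤y) x≤y (^ⁿ-mono-≤ n 0≤x x≤y)

  1^ⁿ≈1 : ∀ n → 1# ^ⁿ n ≈ 1#
  1^ⁿ≈1 zero    = ≈-refl
  1^ⁿ≈1 (suc n) = ≈-trans (*-identityˡ _) (1^ⁿ≈1 n)

  1≤^ⁿ : ∀ {x} n → 1# ≤ x → 1# ≤ x ^ⁿ n
  1≤^ⁿ n 1≤x = ≤-respˡ (1^ⁿ≈1 n) (^ⁿ-mono-≤ n 0≤1 1≤x)

  ^ⁿ≤1 : ∀ {x} n → 0# ≤ x → x ≤ 1# → x ^ⁿ n ≤ 1#
  ^ⁿ≤1 n 0≤x x≤1 = ≤-respʳ (1^ⁿ≈1 n) (^ⁿ-mono-≤ n 0≤x x≤1)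

  ^ⁿ-monoʳ-≤ : ∀ {x m n} → 1# ≤ x → m ℕ.≤ n → x ^ⁿ m ≤ x ^ⁿ n
  ^ⁿ-monoʳ-≤ 1≤x (ℕ.z≤n {n})  = 1≤^ⁿ n 1≤x
  ^ⁿ-monoʳ-≤ 1≤x (ℕ.s≤s m≤n) = *-monoˡ-≤ (≤-trans 0≤1 1≤x) (^ⁿ-monoʳ-≤ 1≤x m≤n)

  ^ⁿ-antiʳ-≤ : ∀ {x m n} → 0# ≤ x → x ≤ 1# → m ℕ.≤ n → x ^ⁿ n ≤ x ^ⁿ m
  ^ⁿ-antiʳ-≤ 0≤x x≤1 (ℕ.z≤n {n})  = ^ⁿ≤1 n 0≤x x≤1
  ^ⁿ-antiʳ-≤ 0≤x x≤1 (ℕ.s≤s m≤n) = *-monoˡ-≤ 0≤x (^ⁿ-antiʳ-≤ 0≤x x≤1 m≤n)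

  ^ⁿ-strict : ∀ {x y} n → .{{NonZero n}} → 0# ≤ x → x < y → x ^ⁿ n < y ^ⁿ n
  ^ⁿ-strict {x} {y} (suc n) 0≤x x<y le = x<y (*-cancelˡ-≤ (^ⁿ-pos n 0<y) (begin
    y ^ⁿ n * y ≈⟨ *-comm _ _ ⟩
    y * y ^ⁿ n ≤⟨ le ⟩
    x * x ^ⁿ n ≤⟨ *-monoˡ-≤ 0≤x (^ⁿ-mono-≤ n 0≤x (<⇒≤ x<y)) ⟩
    x * y ^ⁿ n ≈⟨ *-comm _ _ ⟩
    y ^ⁿ n * x ∎))
    where
    0<y : 0# < y
    0<y = ≤-<-trans 0≤x x<y

  ∣x∣≈x : ∀ {x} → 0# ≤ x → ∣ x ∣ ≈ x
  ∣x∣≈x {x} 0≤x = antisym (⊔.⊔-lub ≤-refl (≤-trans (0≤x⇒-x≤0 0≤x) 0≤x)) (⊔.x≤x⊔y x (- x))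

  ∣-∣-cong : ∀ {x y} → x ≈ y → ∣ x ∣ ≈ ∣ y ∣
  ∣-∣-cong x≈y = ⊔.⊔-cong x≈y (-‿cong x≈y)

  ∣-x∣≈∣x∣ : ∀ x → ∣ - x ∣ ≈ ∣ x ∣
  ∣-x∣≈∣x∣ x = ≈-trans (⊔.⊔-cong ≈-refl (neg-involutive x)) (⊔.⊔-comm (- x) x)

  ∣x∣-nonNeg : ∀ x → 0# ≤ ∣ x ∣
  ∣x∣-nonNeg x with total 0# x
  ... | inj₁ 0≤x = ≤-trans 0≤x (⊔.x≤x⊔y x (- x))
  ... | inj₂ x≤0 = ≤-trans (x≤0⇒0≤-x x≤0) (⊔.x≤y⊔x x (- x))

  ∣x-y∣≈∣y-x∣ : ∀ x y → ∣ x - y ∣ ≈ ∣ y - x ∣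
  ∣x-y∣≈∣y-x∣ x y = ≈-trans (∣-∣-cong (≈-sym eq)) (∣-x∣≈∣x∣ (y - x))
    where
    open import Algebra.Properties.AbelianGroup +-abelianGroup using (⁻¹-anti-homo‿-)
    eq : - (y - x) ≈ x - y
    eq = ⁻¹-anti-homo‿- y x

  x+e≈y⇒∣x-y∣≈e : ∀ {x y e} → 0# ≤ e → x + e ≈ y → ∣ x - y ∣ ≈ e
  x+e≈y⇒∣x-y∣≈e {x} {y} {e} 0≤e eq = ≈-trans (∣x-y∣≈∣y-x∣ x y) (≈-trans (∣-∣-cong y-x≈e) (∣x∣≈x 0≤e))
    where
    y-x≈e : y - x ≈ e
    y-x≈e = ≈-trans (+-comm y (- x)) (≈-trans (+-congˡ (≈-sym eq)) (-x+x+y≈y x e))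

  -- If the naturals were bounded by `x`, they would have a supremum `s`; since n + 1 is below `s`
  -- for every n, `s` minus 1 would be a smaller upper bound.
  archimedean : ∀ x → ∃[ n ] x ≤ fromℕ n
  archimedean x = decidable-stable em absurd
    where
    S : Carrier → Set
    S t = ∃[ n ] t ≈ fromℕ n

    absurd : ¬ ¬ (∃[ n ] x ≤ fromℕ n)
    absurd none = 0<1 (+-cancelˡ-≤ (- 1# + s) (begin
      (- 1# + s) + 1# ≈⟨ ≈-trans (+-assoc _ _ _) (≈-trans (+-congˡ (+-comm s 1#)) (-x+x+y≈y 1# s)) ⟩
      s               ≤⟨ proj₂ isSup bound ⟩
      - 1# + s        ≈⟨ +-identityʳ _ ⟨
      (- 1# + s) + 0# ∎))
      where
      s : Carrier
      s = sup S

      below : ∀ n → fromℕ n ≤ x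
      below n with total (fromℕ n) x
      ... | inj₁ le = le
      ... | inj₂ ge = ⊥-elim (none (n , ge))

      isSup : IsSupremum S s
      isSup = sup-isSupremum (0# , 0 , ≈-refl) (x , λ {(n , eq) → ≤-respˡ (≈-sym eq) (below n)})

      bound : UpperBound S (- 1# + s)
      bound {t} (n , eq) = ≤-respˡ (-x+x+y≈y 1# t)
        (+-monoʳ-≤ (- 1#) (≤-respˡ (+-congˡ (≈-sym eq)) (proj₁ isSup (suc n , ≈-refl))))

  -- Descends from an archimedean bound. The upper inequality is not strict, so at a natural number
  -- the result may be one less than `x`; the choice of block size tolerates this.
  floor : ∀ {x} → 0# ≤ x → ∃[ n ] fromℕ n ≤ x × x ≤ fromℕ (suc n)
  floor {x} 0≤x = let n , le = archimedean x in go n le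
    where
    go : ∀ n → x ≤ fromℕ n → ∃[ n ] fromℕ n ≤ x × x ≤ fromℕ (suc n)
    go zero    le = 0 , 0≤x , ≤-trans le (fromℕ-nonNeg 1)
    go (suc n) le with total (fromℕ n) x
    ... | inj₁ n≤x = n , n≤x , le
    ... | inj₂ x≤n = go n x≤n

-- Finite additivity and averaging over a probability space

module Measure (em : ∀ {ℓ} → ExcludedMiddle ℓ) (ℝ : CompleteOrderedField) (S : Reals.ProbabilitySpace ℝ) where

  open Counting
  open Field em ℝ
  open Reals.ProbabilitySpace S
  open import Relation.Unary using (_⊥_)

  private
    Event : Set₁
    Event = Pred Ω 0ℓ

    variable
      E F : Event

    -- Two events padded with empty ones, to derive finite additivity from the countable axioms.
    sequence : Event → Event → ℕ → Event
    sequence E F 0             = E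
    sequence E F 1             = F
    sequence E F (suc (suc _)) = ∅

  measurable-∅ : Measurable ∅
  measurable-∅ = measurable-resp ((λ ¬u → ¬u _) , λ ()) (measurable-∁ measurable-U)

  module _ (mE : Measurable E) (mF : Measurable F) where

    private
      mSeq : ∀ i → Measurable (sequence E F i)
      mSeq 0             = mE
      mSeq 1             = mF
      mSeq (suc (suc _)) = measurable-∅

      ⋃≐∪ : ⋃ ℕ (sequence E F) ≐ E ∪ F
      ⋃≐∪ = (λ { (0 , e) → inj₁ e ; (1 , f) → inj₂ f }) , [ (0 ,_) , (1 ,_) ]

    measurable-∪ : Measurable (E ∪ F)
    measurable-∪ = measurable-resp ⋃≐∪ (measurable-⋃ mSeq)

    ℙ-sequence : E ⊥ F → IsSupremum (λ s → ∃[ k ] s ≈ sum {k} (λ i → ℙ (sequence E F (toℕ i)))) (ℙ (E ∪ F))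
    ℙ-sequence E⊥F = resp (ℙ-additive mSeq disjoint)
      where
      eq : ℙ (⋃ ℕ (sequence E F)) ≈ ℙ (E ∪ F)
      eq = ℙ-resp ⋃≐∪ (measurable-⋃ mSeq)

      resp : ∀ {S} → IsSupremum S (ℙ (⋃ ℕ (sequence E F))) → IsSupremum S (ℙ (E ∪ F))
      resp (ub , least) = (λ s∈ → ≤-respʳ eq (ub s∈)) , λ bound → ≤-respˡ eq (least bound)

      disjoint : ∀ {i j} → i ≢ j → sequence E F i ⊥ sequence E F j
      disjoint {0}           {0}           i≢j _       = i≢j ≡.refl
      disjoint {0}           {1}           i≢j ef      = E⊥F ef
      disjoint {0}           {suc (suc _)} i≢j (_ , ())
      disjoint {1}           {0}           i≢j (f , e) = E⊥F (e , f)
      disjoint {1}           {1}           i≢j _       = i≢j ≡.refl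
      disjoint {1}           {suc (suc _)} i≢j (_ , ())
      disjoint {suc (suc _)} {_}           i≢j (() , _)

  -- The empty event is disjoint from itself, so the partial sum of two terms gives ℙ ∅ + ℙ ∅ ≤ ℙ ∅.
  ℙ-∅ : ℙ ∅ ≈ 0#
  ℙ-∅ = antisym (+-cancelˡ-≤ (ℙ ∅) (begin
      ℙ ∅ + ℙ ∅         ≈⟨ +-congˡ (+-identityʳ (ℙ ∅)) ⟨
      ℙ ∅ + (ℙ ∅ + 0#)  ≤⟨ proj₁ (ℙ-sequence measurable-∅ measurable-∅ (λ ())) (2 , ≈-refl) ⟩
      ℙ (∅ ∪ ∅)         ≈⟨ ℙ-resp ([ (λ ()) , (λ ()) ] , λ ()) (measurable-∪ measurable-∅ measurable-∅) ⟩
      ℙ ∅               ≈⟨ +-identityʳ (ℙ ∅) ⟨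
      ℙ ∅ + 0#          ∎))
    (ℙ-nonNeg measurable-∅)

  module _ (mE : Measurable E) (mF : Measurable F) where

    ℙ-∪ : E ⊥ F → ℙ (E ∪ F) ≈ ℙ E + ℙ F
    ℙ-∪ E⊥F = antisym (proj₂ isSup bound)
      (≤-respˡ (+-congˡ (+-identityʳ (ℙ F))) (proj₁ isSup (2 , ≈-refl)))
      where
      isSup = ℙ-sequence mE mF E⊥F

      sum-∅ : ∀ k → sum {k} (λ _ → ℙ ∅) ≈ 0#
      sum-∅ zero    = ≈-refl
      sum-∅ (suc k) = ≈-trans (+-cong ℙ-∅ (sum-∅ k)) (+-identityʳ 0#)

      bound : UpperBound _ (ℙ E + ℙ F)
      bound (0 , eq) = ≤-respˡ (≈-sym eq) (+-nonNeg (ℙ-nonNeg mE) (ℙ-nonNeg mF))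
      bound (1 , eq) = ≤-respˡ (≈-sym eq) (+-monoʳ-≤ (ℙ E) (ℙ-nonNeg mF))
      bound (suc (suc k) , eq) = ≤-reflexive (≈-trans eq
        (+-congˡ (≈-trans (+-congˡ (sum-∅ k)) (+-identityʳ (ℙ F)))))

    measurable-∩ : Measurable (E ∩ F)
    measurable-∩ = measurable-resp
      ( (λ ¬∪ → decidable-stable em (λ ¬e → ¬∪ (inj₁ ¬e)) , decidable-stable em (λ ¬f → ¬∪ (inj₂ ¬f)))
      , λ { (e , f) → [ (λ ¬e → ¬e e) , (λ ¬f → ¬f f) ] } )
      (measurable-∁ (measurable-∪ (measurable-∁ mE) (measurable-∁ mF)))

  ℙ-split : Measurable E → Measurable F → ℙ (E ∩ F) + ℙ (E ∩ ∁ F) ≈ ℙ E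
  ℙ-split {E} {F} mE mF = ≈-trans (≈-sym (ℙ-∪ mE∩F mE∩∁F λ { ((_ , f) , (_ , ¬f)) → ¬f f }))
    (ℙ-resp ([ proj₁ , proj₁ ] , split) (measurable-∪ mE∩F mE∩∁F))
    where
    mE∩F = measurable-∩ mE mF
    mE∩∁F = measurable-∩ mE (measurable-∁ mF)

    split : E ⊆ (E ∩ F) ∪ (E ∩ ∁ F)
    split {ω} e with em {P = F ω}
    ... | yes f = inj₁ (e , f)
    ... | no ¬f = inj₂ (e , ¬f)

  ℙ-mono : Measurable E → Measurable F → E ⊆ F → ℙ E ≤ ℙ F
  ℙ-mono {E} {F} mE mF E⊆F = begin
    ℙ E                        ≈⟨ ℙ-resp ((λ e → E⊆F e , e) , proj₂) mE ⟩
    ℙ (F ∩ E)                  ≤⟨ x≤x+y (ℙ-nonNeg (measurable-∩ mF (measurable-∁ mE))) ⟩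
    ℙ (F ∩ E) + ℙ (F ∩ ∁ E)    ≈⟨ ℙ-split mF mE ⟩
    ℙ F                        ∎

  -- Allows the expensive runs, which are covered by a null event, to be removed from a success
  -- event at no cost in probability.
  ℙ-∖-null : Measurable E → Measurable F → ℙ F ≤ 0# → ℙ E ≤ ℙ (E ∩ ∁ F)
  ℙ-∖-null {E} {F} mE mF null = begin
    ℙ E                      ≈⟨ ℙ-split mE mF ⟨
    ℙ (E ∩ F) + ℙ (E ∩ ∁ F)  ≤⟨ +-monoˡ-≤ _ (≤-trans (ℙ-mono (measurable-∩ mE mF) mF proj₂) null) ⟩
    0# + ℙ (E ∩ ∁ F)         ≈⟨ +-identityˡ _ ⟩
    ℙ (E ∩ ∁ F)              ∎

  module _ {I : Set} (F : I → Event) (mF : ∀ i → Measurable (F i)) where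

    multiplicity : List I → Ω → ℕ
    multiplicity is ω = ∑ is λ i → indicator (em {P = F i ω})

    -- The integral of `multiplicity` over `E`, written as a sum of probabilities.
    totalℙ : Event → List I → Carrier
    totalℙ E []       = 0#
    totalℙ E (i ∷ is) = ℙ (E ∩ F i) + totalℙ E is

    totalℙ-split : ∀ {E G} → Measurable E → Measurable G → ∀ is →
      totalℙ E is ≈ totalℙ (E ∩ G) is + totalℙ (E ∩ ∁ G) is
    totalℙ-split mE mG [] = ≈-sym (+-identityˡ 0#)
    totalℙ-split {E} {G} mE mG (i ∷ is) = ≈-trans
      (+-cong (≈-trans (≈-sym (ℙ-split (measurable-∩ mE (mF i)) mG))
        (+-cong (swap mG) (swap (measurable-∁ mG)))) (totalℙ-split mE mG is))
      (solve 4 (λ a b c d → (a :+ b) :+ (c :+ d) := (a :+ c) :+ (b :+ d)) ≈-refl _ _ _ _)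
      where
      swap : ∀ {H} → Measurable H → ℙ ((E ∩ F i) ∩ H) ≈ ℙ ((E ∩ H) ∩ F i)
      swap mH = ℙ-resp ((λ { ((e , f) , h) → (e , h) , f }) , λ { ((e , h) , f) → (e , f) , h })
        (measurable-∩ (measurable-∩ mE (mF i)) mH)

    -- Markov's inequality without integrals: the induction conditions on each event in turn.
    totalℙ≤ : ∀ k c is {E} → Measurable E → (∀ {ω} → E ω → k ℕ.* multiplicity is ω ℕ.≤ c) →
      fromℕ k * totalℙ E is ≤ fromℕ c * ℙ E
    totalℙ≤ k c [] mE le = ≤-respˡ (≈-sym (zeroʳ (fromℕ k))) (*-nonNeg (fromℕ-nonNeg c) (ℙ-nonNeg mE))
    totalℙ≤ k c (i ∷ is) {E} mE le = begin
      K * (a + totalℙ E is)              ≈⟨ *-congˡ (+-congˡ (totalℙ-split mE (mF i) is)) ⟩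
      K * (a + (s + t))                  ≈⟨ solve 4 (λ K a s t → K :* (a :+ (s :+ t)) := (K :* a :+ K :* s) :+ K :* t) ≈-refl K a s t ⟩
      (K * a + K * s) + K * t            ≤⟨ +-mono-≤ inside outside ⟩
      fromℕ c * a + fromℕ c * b          ≈⟨ distribˡ (fromℕ c) a b ⟨
      fromℕ c * (a + b)                  ≈⟨ *-congˡ (ℙ-split mE (mF i)) ⟩
      fromℕ c * ℙ E                      ∎
      where
      K a b s t : Carrier
      K = fromℕ k
      a = ℙ (E ∩ F i)
      b = ℙ (E ∩ ∁ (F i))
      s = totalℙ (E ∩ F i) is
      t = totalℙ (E ∩ ∁ (F i)) is

      outside : K * t ≤ fromℕ c * b
      outside = totalℙ≤ k c is (measurable-∩ mE (measurable-∁ (mF i))) λ {ω} (e , _) →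
        ℕ.≤-trans (ℕ.*-monoʳ-≤ k (ℕ.m≤n+m _ (indicator (em {P = F i ω})))) (le e)

      le′ : ∀ {ω} → (E ∩ F i) ω → k ℕ.+ k ℕ.* multiplicity is ω ℕ.≤ c
      le′ {ω} (e , f) = ≡.subst (ℕ._≤ c) (≡.trans
        (≡.cong (λ n → k ℕ.* (n ℕ.+ multiplicity is ω)) (indicator-yes (em {P = F i ω}) f)) (ℕ.*-suc k _)) (le e)

      -- On `F i` this event alone uses up `k` of the budget `c`, so the recursion continues with
      -- `c′`, where k + c′ = c. If `k` exceeds `c`, then `E ∩ F i` is empty and both sides vanish.
      inside : K * a + K * s ≤ fromℕ c * a
      inside with k ℕ.≤? c
      ... | no k≰c = begin
        K * a + K * s                  ≤⟨ +-monoʳ-≤ (K * a) (totalℙ≤ k 0 is (measurable-∩ mE (mF i)) λ ef → ⊥-elim (empty ef)) ⟩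
        K * a + 0# * a                 ≈⟨ ≈-trans (+-cong (≈-trans (*-congˡ a≈0) (zeroʳ K)) (zeroˡ a)) (+-identityʳ 0#) ⟩
        0#                             ≈⟨ ≈-trans (*-congˡ a≈0) (zeroʳ (fromℕ c)) ⟨
        fromℕ c * a                    ∎
        where
        empty : ∀ {ω} → ¬ (E ∩ F i) ω
        empty ef = k≰c (ℕ.≤-trans (ℕ.m≤m+n k _) (le′ ef))

        a≈0 : a ≈ 0#
        a≈0 = ≈-trans (ℙ-resp ((λ ef → ⊥-elim (empty ef)) , λ ()) (measurable-∩ mE (mF i))) ℙ-∅
      ... | yes k≤c with ℕ.m≤n⇒∃[o]m+o≡n k≤c
      ...   | c′ , ≡.refl = begin
        K * a + K * s                  ≤⟨ +-monoʳ-≤ (K * a) (totalℙ≤ k c′ is (measurable-∩ mE (mF i))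
                                            λ ef → ℕ.+-cancelˡ-≤ k _ _ (le′ ef)) ⟩
        K * a + fromℕ c′ * a           ≈⟨ distribʳ a K _ ⟨
        (K + fromℕ c′) * a             ≈⟨ *-congʳ (fromℕ-+ k c′) ⟨
        fromℕ (k ℕ.+ c′) * a           ∎

    -- The sum of the probabilities is at least `length is` times `q` and, by `totalℙ≤` on the whole
    -- space, at most c/k. It is the contrapositive of choosing a point that lies in at least an
    -- average number of the events.
    multiplicity-bound : ∀ k c is {q} → (∀ i → q ≤ ℙ (F i)) →
      (∀ ω → k ℕ.* multiplicity is ω ℕ.≤ c) → fromℕ k * (fromℕ (length is) * q) ≤ fromℕ c
    multiplicity-bound k c is {q} q≤ le = begin
      fromℕ k * (fromℕ (length is) * q) ≤⟨ *-monoˡ-≤ (fromℕ-nonNeg k) (total≥ is) ⟩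
      fromℕ k * totalℙ U is             ≤⟨ totalℙ≤ k c is measurable-U (λ {ω} _ → le ω) ⟩
      fromℕ c * ℙ U                     ≈⟨ ≈-trans (*-congˡ ℙ-U) (*-identityʳ (fromℕ c)) ⟩
      fromℕ c                           ∎
      where
      total≥ : ∀ is → fromℕ (length is) * q ≤ totalℙ U is
      total≥ [] = ≤-reflexive (zeroˡ q)
      total≥ (i ∷ is) = begin
        (1# + fromℕ (length is)) * q    ≈⟨ ≈-trans (distribʳ q 1# _) (+-congʳ (*-identityˡ q)) ⟩
        q + fromℕ (length is) * q       ≤⟨ +-mono-≤ (≤-trans (q≤ i) (≤-reflexive (ℙ-resp ((_ ,_) , proj₂) (mF i)))) (total≥ is) ⟩
        ℙ (U ∩ F i) + totalℙ U is       ∎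

-- Real powers with exponent above 2, read off the defining cut

module Power (em : ∀ {ℓ} → ExcludedMiddle ℓ) (ℝ : CompleteOrderedField)
  (p : CompleteOrderedField.Carrier ℝ) (2<p : CompleteOrderedField._<_ ℝ (CompleteOrderedField.fromℕ ℝ 2) p) where

  open Field em ℝ

  ^ⁿ-cancel-≤ : ∀ {s t} k → .{{NonZero k}} → 0# ≤ s → t ^ⁿ k ≤ s ^ⁿ k → t ≤ s
  ^ⁿ-cancel-≤ k 0≤s le = decidable-stable em λ s<t → ^ⁿ-strict k 0≤s s<t le

  ^ⁿ≤1⇒≤1 : ∀ {t} k → .{{NonZero k}} → t ^ⁿ k ≤ 1# → t ≤ 1#
  ^ⁿ≤1⇒≤1 k le = ^ⁿ-cancel-≤ k 0≤1 (≤-respʳ (≈-sym (1^ⁿ≈1 k)) le)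

  0≤p : 0# ≤ p
  0≤p = ≤-trans (fromℕ-nonNeg 2) (<⇒≤ 2<p)

  x*1≈x : ∀ x → x * fromℕ 1 ≈ x
  x*1≈x x = ≈-trans (*-congˡ (+-identityʳ 1#)) (*-identityʳ x)

  2k≤m : ∀ m k → p * fromℕ k ≤ fromℕ m → 2 ℕ.* k ℕ.≤ m
  2k≤m m k pk≤m = fromℕ-cancel-≤ (2 ℕ.* k) m
    (≤-respˡ (≈-sym (fromℕ-* 2 k)) (≤-trans (*-monoʳ-≤ (fromℕ-nonNeg k) (<⇒≤ 2<p)) pk≤m))

  k≤m : ∀ m k → p * fromℕ k ≤ fromℕ m → k ℕ.≤ m
  k≤m m k pk≤m = ℕ.≤-trans (ℕ.m≤m+n k _) (2k≤m m k pk≤m)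

  -- Some natural number above `p`, not necessarily the least one.
  ⌈p⌉ : ℕ
  ⌈p⌉ = proj₁ (archimedean p)

  p≤⌈p⌉ : p ≤ fromℕ ⌈p⌉
  p≤⌈p⌉ = proj₂ (archimedean p)

  m≤⌈p⌉k : ∀ m k → fromℕ m ≤ p * fromℕ k → m ℕ.≤ ⌈p⌉ ℕ.* k
  m≤⌈p⌉k m k m≤pk = fromℕ-cancel-≤ m (⌈p⌉ ℕ.* k)
    (≤-respʳ (≈-sym (fromℕ-* ⌈p⌉ k)) (≤-trans m≤pk (*-monoʳ-≤ (fromℕ-nonNeg k) p≤⌈p⌉)))

  ∈cut-small : ∀ {x t} → 1# ≤ x → 0# ≤ t → t ≤ 1# → PowerCut x p t
  ∈cut-small {t = t} 1≤x 0≤t t≤1 = 0≤t , 0 , 1 , _ , ≤-respˡ (≈-sym (*-identityʳ t)) t≤1 ,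
    inj₁ (1≤x , *-nonNeg 0≤p (fromℕ-nonNeg 1))

  ∈cut-⌈p⌉ : ∀ {x} → 0# ≤ x → x ≤ 1# → PowerCut x p (x ^ⁿ ⌈p⌉)
  ∈cut-⌈p⌉ {x} 0≤x x≤1 = ^ⁿ-nonNeg ⌈p⌉ 0≤x , ⌈p⌉ , 1 , _ , ≤-reflexive (*-identityʳ _) ,
    inj₂ (x≤1 , ≤-respˡ (≈-sym (x*1≈x p)) p≤⌈p⌉)

  PowerCut-satisfiable : ∀ {x} → 0# ≤ x → Satisfiable (PowerCut x p)
  PowerCut-satisfiable {x} 0≤x with total x 1#
  ... | inj₁ x≤1 = _ , ∈cut-⌈p⌉ 0≤x x≤1
  ... | inj₂ 1≤x = 0# , ∈cut-small 1≤x ≤-refl 0≤1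

  -- The bound is a sum so as to cover both ranges: for `x` at least 1 the cut lies below
  -- `x ^ⁿ ⌈p⌉`, for `x` at most 1 it lies below 1.
  PowerCut-bounded : ∀ {x} → 0# ≤ x → UpperBound (PowerCut x p) (1# + x ^ⁿ ⌈p⌉)
  PowerCut-bounded {x} 0≤x (_ , m , k , k≢0 , le , inj₁ (1≤x , m≤pk)) =
    ≤-trans (^ⁿ-cancel-≤ k {{k≢0}} (^ⁿ-nonNeg ⌈p⌉ 0≤x) (≤-trans le
      (≤-respʳ (≈-sym (^-assocʳ x ⌈p⌉ k)) (^ⁿ-monoʳ-≤ 1≤x (m≤⌈p⌉k m k m≤pk)))))
      (x≤y+x 0≤1)
  PowerCut-bounded {x} 0≤x (_ , m , k , k≢0 , le , inj₂ (x≤1 , _)) =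
    ≤-trans (^ⁿ≤1⇒≤1 k {{k≢0}} (≤-trans le (^ⁿ≤1 m 0≤x x≤1))) (x≤x+y (^ⁿ-nonNeg ⌈p⌉ 0≤x))

  ^-isSupremum : ∀ {x} → 0# ≤ x → IsSupremum (PowerCut x p) (x ^ p)
  ^-isSupremum 0≤x = sup-isSupremum (PowerCut-satisfiable 0≤x) (_ , PowerCut-bounded 0≤x)

  ^-nonNeg : ∀ {x} → 0# ≤ x → 0# ≤ x ^ p
  ^-nonNeg 0≤x with PowerCut-satisfiable 0≤x
  ... | t , t∈ = ≤-trans (proj₁ t∈) (proj₁ (^-isSupremum 0≤x) t∈)

  ^-pos : ∀ {x} → 0# < x → x ≤ 1# → 0# < x ^ p
  ^-pos 0<x x≤1 = <-≤-trans (^ⁿ-pos ⌈p⌉ 0<x)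
    (proj₁ (^-isSupremum (<⇒≤ 0<x)) (∈cut-⌈p⌉ (<⇒≤ 0<x) x≤1))

  ^-mono-≤ : ∀ {x y} → 0# ≤ x → x ≤ y → x ^ p ≤ y ^ p
  ^-mono-≤ {x} {y} 0≤x x≤y = proj₂ (^-isSupremum 0≤x) λ t∈ → proj₁ (^-isSupremum 0≤y) (cut-mono t∈)
    where
    0≤y : 0# ≤ y
    0≤y = ≤-trans 0≤x x≤y

    cut-mono : ∀ {t} → PowerCut x p t → PowerCut y p t
    cut-mono (0≤t , m , k , k≢0 , le , inj₁ (1≤x , m≤pk)) =
      0≤t , m , k , k≢0 , ≤-trans le (^ⁿ-mono-≤ m 0≤x x≤y) , inj₁ (≤-trans 1≤x x≤y , m≤pk)
    cut-mono (0≤t , m , k , k≢0 , le , inj₂ (x≤1 , pk≤m)) with total y 1#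
    ... | inj₁ y≤1 = 0≤t , m , k , k≢0 , ≤-trans le (^ⁿ-mono-≤ m 0≤x x≤y) , inj₂ (y≤1 , pk≤m)
    -- The exponent m/k ≥ p is admissible only for bases up to 1. But `x ≤ 1` forces `t ≤ 1`, and
    -- the exponent 0 then puts `t` into the cut of `y`.
    ... | inj₂ 1≤y = ∈cut-small 1≤y 0≤t (^ⁿ≤1⇒≤1 k {{k≢0}} (≤-trans le (^ⁿ≤1 m 0≤x x≤1)))

  ^-cong : ∀ {x y} → 0# ≤ x → x ≈ y → x ^ p ≈ y ^ p
  ^-cong 0≤x x≈y = antisym (^-mono-≤ 0≤x (≤-reflexive x≈y))
    (^-mono-≤ (≤-respʳ x≈y 0≤x) (≤-reflexive (≈-sym x≈y)))

  -- Since p ≥ 2, membership in the cut of x ≤ 1 is always witnessed by an exponent m / k ≥ 2.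
  cut≤1 : ∀ {x t} → 0# ≤ x → x ≤ 1# → PowerCut x p t →
          ∃[ m ] ∃[ k ] NonZero k × 2 ℕ.* k ℕ.≤ m × p * fromℕ k ≤ fromℕ m × t ^ⁿ k ≤ x ^ⁿ m
  cut≤1 {x} {t} 0≤x x≤1 (_ , m , k , k≢0 , le , inj₂ (_ , pk≤m)) = m , k , k≢0 , 2k≤m m k pk≤m , pk≤m , le
  -- Here `x` equals 1, so the given exponent can be replaced by `⌈p⌉`: both powers are 1 and
  -- `t ≤ 1`.
  cut≤1 {x} {t} 0≤x x≤1 (_ , m , k , k≢0 , le , inj₁ (1≤x , _)) =
    ⌈p⌉ , 1 , _ , 2k≤m ⌈p⌉ 1 p1≤ , p1≤ , ≤-respˡ (≈-sym (*-identityʳ t))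
      (≤-trans (^ⁿ≤1⇒≤1 k {{k≢0}} (≤-trans le (^ⁿ≤1 m 0≤x x≤1))) (1≤^ⁿ ⌈p⌉ 1≤x))
    where
    p1≤ : p * fromℕ 1 ≤ fromℕ ⌈p⌉
    p1≤ = ≤-respˡ (≈-sym (x*1≈x p)) p≤⌈p⌉

  -- For a witness m/k ≥ 2 one has t^k ≤ x^m ≤ (x * x)^k, because `x ≤ 1`; then take k-th roots.
  ^≤square : ∀ {x} → 0# ≤ x → x ≤ 1# → x ^ p ≤ x * x
  ^≤square {x} 0≤x x≤1 = proj₂ (^-isSupremum 0≤x) bound
    where
    bound : UpperBound (PowerCut x p) (x * x)
    bound t∈ with cut≤1 0≤x x≤1 t∈
    ... | m , k , k≢0 , 2k≤ , _ , le = ^ⁿ-cancel-≤ k {{k≢0}} (*-nonNeg 0≤x 0≤x) (≤-trans le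
      (≤-respʳ (≈-trans (≈-sym (^-assocʳ x 2 k)) (^-congˡ k (*-congˡ (*-identityʳ x))))
        (^ⁿ-antiʳ-≤ 0≤x x≤1 2k≤)))

  0^≈0 : 0# ^ p ≈ 0#
  0^≈0 = antisym (≤-respʳ (zeroˡ 0#) (^≤square ≤-refl 0≤1)) (^-nonNeg ≤-refl)

  -- Multiplication by `y` maps the cut of `x` into the cut of `x * y`: witnesses satisfy k ≤ m, so
  -- y^k ≤ y^m for `y ≥ 1`. This superlinear growth takes the place of convexity.
  ^-scale : ∀ {x y} → 0# ≤ x → 1# ≤ y → x * y ≤ 1# → x ^ p * y ≤ (x * y) ^ p
  ^-scale {x} {y} 0≤x 1≤y xy≤1 = begin
    x ^ p * y              ≈⟨ *-comm _ y ⟩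
    y * x ^ p              ≤⟨ *-monoˡ-≤ 0≤y (proj₂ (^-isSupremum 0≤x) bound) ⟩
    y * ((x * y) ^ p / y)  ≈⟨ /-cancel 0<y ⟩
    (x * y) ^ p            ∎
    where
    0<y : 0# < y
    0<y = <-≤-trans 0<1 1≤y

    0≤y : 0# ≤ y
    0≤y = <⇒≤ 0<y

    0≤xy : 0# ≤ x * y
    0≤xy = *-nonNeg 0≤x 0≤y

    x≤1 : x ≤ 1#
    x≤1 = ≤-trans (≤-respˡ (*-identityʳ x) (*-monoˡ-≤ 0≤x 1≤y)) xy≤1

    cut-scale : ∀ {t} → PowerCut x p t → PowerCut (x * y) p (t * y)
    cut-scale {t} t∈@(0≤t , _) with cut≤1 0≤x x≤1 t∈
    ... | m , k , k≢0 , _ , pk≤m , le = *-nonNeg 0≤t 0≤y , m , k , k≢0 , (begin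
      (t * y) ^ⁿ k      ≈⟨ ^-distrib-* t y k ⟩
      t ^ⁿ k * y ^ⁿ k   ≤⟨ *-mono-≤ (^ⁿ-nonNeg k 0≤y) (^ⁿ-nonNeg m 0≤x) le (^ⁿ-monoʳ-≤ 1≤y (k≤m m k pk≤m)) ⟩
      x ^ⁿ m * y ^ⁿ m   ≈⟨ ^-distrib-* x y m ⟨
      (x * y) ^ⁿ m      ∎) , inj₂ (xy≤1 , pk≤m)

    bound : UpperBound (PowerCut x p) ((x * y) ^ p / y)
    bound {t} t∈ = *-cancelˡ-≤ 0<y (begin
      y * t                 ≈⟨ *-comm y t ⟩
      t * y                 ≤⟨ proj₁ (^-isSupremum 0≤xy) (cut-scale t∈) ⟩
      (x * y) ^ p           ≈⟨ /-cancel 0<y ⟨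
      y * ((x * y) ^ p / y) ∎)

-- The hard instance and its optimum

module HardInstance (em : ∀ {ℓ} → ExcludedMiddle ℓ) (ℝ : CompleteOrderedField)
  (p : CompleteOrderedField.Carrier ℝ) (2<p : CompleteOrderedField._<_ ℝ (CompleteOrderedField.fromℕ ℝ 2) p) where

  open Counting
  open Field em ℝ
  open Power em ℝ p 2<p
  open Queries em ℝ
  open Reals ℝ using (Matrix; _·_; ‖_‖^_; Lip₁; loss; AttainsOPT; IsReference)
  open import Algebra.Properties.Semiring.Sum semiring using (∑-distrib-+) renaming (sum-cong-≋ to sum-cong)

  sum-mono : ∀ {n} {f g : Vector Carrier n} → (∀ i → f i ≤ g i) → sum f ≤ sum g
  sum-mono {zero}  f≤g = ≤-refl
  sum-mono {suc n} f≤g = +-mono-≤ (f≤g zero) (sum-mono (f≤g ∘ suc))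

  sum-const : ∀ n x → sum {n} (λ _ → x) ≈ fromℕ n * x
  sum-const zero    x = ≈-sym (zeroˡ x)
  sum-const (suc n) x = ≈-trans (+-cong (≈-sym (*-identityˡ x)) (sum-const n x)) (≈-sym (distribʳ x 1# (fromℕ n)))

  sum-0 : ∀ {n} {f : Vector Carrier n} → (∀ i → f i ≈ 0#) → sum f ≈ 0#
  sum-0 {n} f≈0 = ≈-trans (sum-cong f≈0) (≈-trans (sum-const n 0#) (zeroʳ (fromℕ n)))

  -- Passes from an optimal total loss to optimality in every single block.
  sum-squeeze : ∀ {n} {f g : Vector Carrier n} → (∀ i → f i ≤ g i) → sum g ≤ sum f → ∀ i → g i ≤ f i
  sum-squeeze {suc n} {f} {g} f≤g le zero = +-cancelˡ-≤ (sum (g ∘ suc)) (begin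
    sum (g ∘ suc) + g zero ≈⟨ +-comm _ _ ⟩
    sum g                  ≤⟨ le ⟩
    f zero + sum (f ∘ suc) ≤⟨ +-monoʳ-≤ _ (sum-mono (f≤g ∘ suc)) ⟩
    f zero + sum (g ∘ suc) ≈⟨ +-comm _ _ ⟩
    sum (g ∘ suc) + f zero ∎)
  sum-squeeze {suc n} {f} {g} f≤g le (suc i) = sum-squeeze (f≤g ∘ suc)
    (+-cancelˡ-≤ (g zero) (≤-trans le (+-monoˡ-≤ _ (f≤g zero)))) i

  -- The sum consists of n - 1 copies of `a` and one `b`; adding `a` on the left avoids the
  -- predecessor.
  sum-except : ∀ {n} (g : Vector Carrier n) k {a b} → (∀ i → i ≢ k → g i ≈ a) → g k ≈ b →
    sum g + a ≈ fromℕ n * a + b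
  sum-except {suc n} g zero {a} {b} rest at = ≈-trans
    (+-congʳ (+-cong at (≈-trans (sum-cong λ i → rest (suc i) λ ()) (sum-const n a))))
    (solve 3 (λ a b n → (b :+ n :* a) :+ a := (con 1 :+ n) :* a :+ b) ≈-refl a b (fromℕ n))
  sum-except {suc n} g (suc k) {a} {b} rest at = ≈-trans (+-assoc _ _ _) (≈-trans
    (+-cong (rest zero λ ()) (sum-except (g ∘ suc) k (λ i i≢k → rest (suc i) (i≢k ∘ Fin.suc-injective)) at))
    (solve 3 (λ a b n → a :+ (n :* a :+ b) := (con 1 :+ n) :* a :+ b) ≈-refl a b (fromℕ n)))

  sum-splitAt : ∀ m {n} (F : Fin m ⊎ Fin n → Carrier) →
    sum (F ∘ splitAt m) ≈ sum (F ∘ inj₁) + sum (F ∘ inj₂)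
  sum-splitAt zero    F = ≈-sym (+-identityˡ _)
  sum-splitAt (suc m) F = ≈-trans (+-congˡ (sum-splitAt m (F ∘ Sum.map₁ suc))) (≈-sym (+-assoc _ _ _))

  sum-fromℕ : ∀ {n} (f : Fin n → ℕ) x → sum (λ i → fromℕ (f i) * x) ≈ fromℕ (∑ (allFin n) f) * x
  sum-fromℕ {n} f x = go n (λ i → i)
    where
    go : ∀ m (g : Fin m → Fin n) → sum (λ i → fromℕ (f (g i)) * x) ≈ fromℕ (∑ (List.tabulate g) f) * x
    go zero    g = ≈-sym (zeroˡ x)
    go (suc m) g = ≈-trans (+-congˡ (go m (g ∘ suc))) (≈-trans (≈-sym (distribʳ x _ _))
      (*-congʳ (≈-sym (fromℕ-+ (f (g zero)) _))))

  extend : ∀ {d h m} → Bool → (Fin m → Maybe (Label (suc d) h)) → Fin h ⊎ Fin m → Maybe (Label (suc d) h)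
  extend s f (inj₁ k) = just (zero , s , k)
  extend s f (inj₂ i) = f i

  mutual
    -- Decodes a row index. `label` takes off the `h` rows of sign `true` of the first block,
    -- `label′` the `h` rows of sign `false`; the remaining rows belong to later blocks or are
    -- padding.
    label : ∀ r h d → Fin (rows r h d) → Maybe (Label d h)
    label r h zero    i = nothing
    label r h (suc d) i = extend true (label′ r h d) (splitAt h i)

    label′ : ∀ r h d → Fin (h ℕ.+ rows r h d) → Maybe (Label (suc d) h)
    label′ r h d i = extend false (Maybe.map (map₁ suc) ∘ label r h d) (splitAt h i)

  -- Regroups a sum over rows by block and sign. It serves both the loss and the norm, whose terms
  -- vanish on padding rows.
  sum-label : ∀ r h d (G : Maybe (Label d h) → Carrier) → G nothing ≈ 0# →
    sum (G ∘ label r h d) ≈ sum λ j → sum (λ k → G (just (j , true , k))) + sum (λ k → G (just (j , false , k)))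
  sum-label r h zero    G G0 = sum-0 {r} λ _ → G0
  sum-label r h (suc d) G G0 = ≈-trans (sum-splitAt h (G ∘ extend true (label′ r h d)))
    (≈-trans (+-congˡ (sum-splitAt h (G ∘ extend false (Maybe.map (map₁ suc) ∘ label r h d))))
    (≈-trans (≈-sym (+-assoc _ _ _)) (+-congˡ (sum-label r h d (G ∘ Maybe.map (map₁ suc)) G0))))

  sign : Bool → Carrier
  sign true  = 1#
  sign false = - 1#

  sign-not : ∀ s x → sign (not s) * x ≈ - (sign s * x)
  sign-not true  x = ≈-sym (-‿distribˡ-* 1# x)
  sign-not false x = ≈-trans (*-congʳ (≈-sym (neg-involutive 1#))) (≈-sym (-‿distribˡ-* (- 1#) x))

  ∣sign∣ : ∀ s x → ∣ sign s * x ∣ ≈ ∣ x ∣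
  ∣sign∣ true  x = ∣-∣-cong (*-identityˡ x)
  ∣sign∣ false x = ≈-trans (∣-∣-cong (≈-trans (≈-sym (-‿distribˡ-* 1# x)) (-‿cong (*-identityˡ x)))) (∣-x∣≈∣x∣ x)

  sign-sign : ∀ s x → sign s * (sign s * x) ≈ x
  sign-sign true  x = ≈-trans (*-identityˡ _) (*-identityˡ x)
  sign-sign false x = ≈-trans (sign-not true (- 1# * x)) (≈-trans (-‿cong (*-identityˡ _))
    (≈-trans (-‿cong (≈-trans (≈-sym (-‿distribˡ-* 1# x)) (-‿cong (*-identityˡ x)))) (neg-involutive x)))

  coefficients : ∀ {d h} → Maybe (Label d h) → Vector Carrier d
  coefficients nothing            j = 0#
  coefficients (just (i , s , k)) j = if does (i Fin.≟ j) then sign s else 0#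

  dot : ∀ {d h} → Maybe (Label d h) → Vector Carrier d → Carrier
  dot l x = sum λ j → coefficients l j * x j

  dot-nothing : ∀ {d h} x → dot {d} {h} nothing x ≈ 0#
  dot-nothing x = sum-0 λ j → zeroˡ (x j)

  dot-just : ∀ {d h} j s (k : Fin h) x → dot {d} (just (j , s , k)) x ≈ sign s * x j
  dot-just {suc d} zero    s k x = ≈-trans (+-congˡ (sum-0 λ j → zeroˡ (x (suc j)))) (+-identityʳ _)
  dot-just {suc d} (suc j) s k x = ≈-trans (+-cong (zeroˡ (x zero)) (dot-just j s k (x ∘ suc))) (+-identityˡ _)

  -- The clipping function as an element of the class of 1-Lipschitz functions

  module Clip (ε : Carrier) (0<ε : 0# < ε) where

    clip : Carrier → Carrier
    clip t = ε ⊓ (0# ⊔ t)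

    clip-nonNeg : ∀ t → 0# ≤ clip t
    clip-nonNeg t = ⊓.⊓-glb (<⇒≤ 0<ε) (⊔.x≤x⊔y 0# t)

    clip≤ε : ∀ t → clip t ≤ ε
    clip≤ε t = ⊓.x⊓y≤x ε (0# ⊔ t)

    clip-mono : ∀ {s t} → s ≤ t → clip s ≤ clip t
    clip-mono s≤t = ⊓.⊓-monoʳ-≤ ε (⊔.⊔-monoʳ-≤ 0# s≤t)

    clip-neg : ∀ {t} → t ≤ 0# → clip t ≈ 0#
    clip-neg {t} t≤0 = antisym (≤-trans (⊓.x⊓y≤y ε (0# ⊔ t)) (⊔.⊔-lub ≤-refl t≤0)) (clip-nonNeg t)

    clip-large : ∀ {t} → ε ≤ t → clip t ≈ ε
    clip-large {t} ε≤t = antisym (clip≤ε t) (⊓.⊓-glb ≤-refl (≤-trans ε≤t (⊔.x≤y⊔x 0# t)))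

    clip-large⁻¹ : ∀ {t} → ε ≤ clip t → ε ≤ t
    clip-large⁻¹ {t} le with ⊔.⊔-sel 0# t
    ... | inj₁ eq = ⊥-elim (0<ε (≤-trans le (≤-respʳ eq (⊓.x⊓y≤y ε (0# ⊔ t)))))
    ... | inj₂ eq = ≤-trans le (≤-respʳ eq (⊓.x⊓y≤y ε (0# ⊔ t)))

    clip-increase : ∀ {s t e} → 0# ≤ e → s + e ≈ t → clip t ≤ clip s + e
    clip-increase {s} {t} {e} 0≤e eq with ⊓.⊓-sel ε (0# ⊔ s)
    ... | inj₁ sel = ≤-trans (clip≤ε t) (≤-respʳ (+-congʳ (≈-sym sel)) (x≤x+y 0≤e))
    ... | inj₂ sel = ≤-trans (⊓.x⊓y≤y ε (0# ⊔ t)) (≤-respʳ (+-congʳ (≈-sym sel))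
      (⊔.⊔-lub (+-nonNeg (⊔.x≤x⊔y 0# s) 0≤e) (≤-respˡ eq (+-monoˡ-≤ e (⊔.x≤y⊔x 0# s)))))

    clip-lipschitz-≤ : ∀ {x y} → x ≤ y → ∣ clip x - clip y ∣ ≤ ∣ x - y ∣
    clip-lipschitz-≤ {x} {y} x≤y = begin
      ∣ clip x - clip y ∣ ≈⟨ x+e≈y⇒∣x-y∣≈e (x≤y⇒0≤y-x (clip-mono x≤y)) (x+[y-x]≈y _ _) ⟩
      clip y - clip x     ≤⟨ +-cancelˡ-≤ (clip x) (≤-respˡ (≈-sym (x+[y-x]≈y _ _))
                               (clip-increase 0≤y-x (x+[y-x]≈y x y))) ⟩
      y - x               ≈⟨ x+e≈y⇒∣x-y∣≈e 0≤y-x (x+[y-x]≈y x y) ⟨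
      ∣ x - y ∣           ∎
      where
      0≤y-x : 0# ≤ y - x
      0≤y-x = x≤y⇒0≤y-x x≤y

    clip-Lip₁ : Lip₁
    clip-Lip₁ = record
      { fun       = clip
      ; fun-zero  = clip-neg ≤-refl
      ; lipschitz = lipschitz
      }
      where
      lipschitz : ∀ x y → ∣ clip x - clip y ∣ ≤ ∣ x - y ∣
      lipschitz x y with total x y
      ... | inj₁ x≤y = clip-lipschitz-≤ x≤y
      ... | inj₂ y≤x = ≤-respˡ (∣x-y∣≈∣y-x∣ (clip y) (clip x))
        (≤-respʳ (∣x-y∣≈∣y-x∣ y x) (clip-lipschitz-≤ y≤x))

  -- A wrong sign costs (K − 1) w ε = 32 w ε, against an error budget of 4 w ε per block: whence
  -- the admissible fraction 1/8 of wrong signs.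
  K μ w : Carrier
  K = fromℕ 33
  μ = K ⁻¹
  w = μ ^ p

  0<K : 0# < K
  0<K = fromℕ-pos {33} (ℕ.s≤s ℕ.z≤n)

  0<μ : 0# < μ
  0<μ = ⁻¹-pos 0<K

  0≤μ : 0# ≤ μ
  0≤μ = <⇒≤ 0<μ

  Kμ≈1 : K * μ ≈ 1#
  Kμ≈1 = ⁻¹-inverseʳ (0<⇒≉0 0<K)

  μ+μ≤1 : μ + μ ≤ 1#
  μ+μ≤1 = begin
    μ + μ         ≈⟨ solve 1 (λ m → m :+ m := (con 1 :+ (con 1 :+ con 0)) :* m) ≈-refl μ ⟩
    fromℕ 2 * μ   ≤⟨ *-monoʳ-≤ 0≤μ (fromℕ-mono {2} {33} (ℕ.s≤s (ℕ.s≤s ℕ.z≤n))) ⟩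
    K * μ         ≈⟨ Kμ≈1 ⟩
    1#            ∎

  μ≤1 : μ ≤ 1#
  μ≤1 = ≤-trans (x≤x+y 0≤μ) μ+μ≤1

  0<w : 0# < w
  0<w = ^-pos 0<μ μ≤1

  w≤μ : w ≤ μ
  w≤μ = ≤-trans (^≤square 0≤μ μ≤1) (≤-respʳ (*-identityʳ μ) (*-monoˡ-≤ 0≤μ μ≤1))

  w≤1 : w ≤ 1#
  w≤1 = ≤-trans w≤μ μ≤1

  -- Since K μ = 1, μ + u is μ times 1 + K u, and `^-scale` pulls out this factor. It stands in for
  -- the tangent bound on the convex power.
  w+wKu≤[μ+u]^p : ∀ {u} → 0# ≤ u → μ + u ≤ 1# → w + w * (K * u) ≤ (μ + u) ^ p
  w+wKu≤[μ+u]^p {u} 0≤u μ+u≤1 = begin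
    w + w * (K * u)             ≈⟨ solve 2 (λ w t → w :+ w :* t := w :* (con 1 :+ t)) ≈-refl w (K * u) ⟩
    w * (1# + K * u)            ≤⟨ ^-scale 0≤μ (x≤x+y (*-nonNeg (<⇒≤ 0<K) 0≤u)) (≤-respˡ (≈-sym eq) μ+u≤1) ⟩
    (μ * (1# + K * u)) ^ p      ≤⟨ ^-mono-≤ (≤-respʳ (≈-sym eq) (+-nonNeg 0≤μ 0≤u)) (≤-reflexive eq) ⟩
    (μ + u) ^ p                 ∎
    where
    eq : μ * (1# + K * u) ≈ μ + u
    eq = ≈-trans (solve 3 (λ m k u → m :* (con 1 :+ k :* u) := m :+ (k :* m) :* u) ≈-refl μ K u)
      (+-congˡ (≈-trans (*-congʳ Kμ≈1) (*-identityˡ u)))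

  -- Loss of a block, the reference solution, and what accuracy implies

  module Instance (ε : Carrier) (0<ε : 0# < ε) (ε≤w : ε ≤ w) (h : ℕ) .{{_ : NonZero h}}
    (hε^p≤w : fromℕ h * ε ^ p ≤ w) (r d : ℕ) where

    open Clip ε 0<ε

    0≤ε : 0# ≤ ε
    0≤ε = <⇒≤ 0<ε

    -- `B` is the optimal loss of a block: the `h` rows of the sign that is not fitted cost `ε ^ p`
    -- each, and the hidden row costs `μ ^ p`.
    e B : Carrier
    e = ε ^ p
    B = fromℕ h * e + w

    ε≤1 : ε ≤ 1#
    ε≤1 = ≤-trans ε≤w w≤1

    e≤wε : e ≤ w * ε
    e≤wε = ≤-trans (^≤square 0≤ε ε≤1) (*-monoʳ-≤ 0≤ε ε≤w)

    A : Matrix (rows r h d) d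
    A i = coefficients (label r h d i)

    b : Vec (Slot h) d → Vector Carrier (rows r h d)
    b z i = entry ε (ε + μ) z (label r h d i)

    x⋆ : Vec (Slot h) d → Vector Carrier d
    x⋆ z j = sign (proj₁ (lookup z j)) * ε

    rowLoss : Vec (Slot h) d → Vector Carrier d → Maybe (Label d h) → Carrier
    rowLoss z x l = ∣ clip (dot l x) - entry ε (ε + μ) z l ∣ ^ p

    blockLoss : Vec (Slot h) d → Vector Carrier d → Fin d → Carrier
    blockLoss z x j = sum (λ k → rowLoss z x (just (j , true , k))) + sum (λ k → rowLoss z x (just (j , false , k)))

    rowLoss-nothing : ∀ z x → rowLoss z x nothing ≈ 0#
    rowLoss-nothing z x = ≈-trans (^-cong (∣x∣-nonNeg _)
      (x+e≈y⇒∣x-y∣≈e ≤-refl (≈-trans (+-identityʳ _) (clip-neg (≤-reflexive (dot-nothing {d} {h} x)))))) 0^≈0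

    loss≈blocks : ∀ z x → loss p A clip-Lip₁ (b z) x ≈ sum (blockLoss z x)
    loss≈blocks z x = sum-label r h d (rowLoss z x) (rowLoss-nothing z x)

    module Block (z : Vec (Slot h) d) (x : Vector Carrier d) (j : Fin d) where

      s : Bool
      s = proj₁ (lookup z j)

      k₀ : Fin h
      k₀ = proj₂ (lookup z j)

      -- The shortfall on the rows of one sign: ordinary rows have this residual in absolute value,
      -- and the hidden row has `μ` more.
      u : Bool → Carrier
      u s = ε - clip (sign s * x j)

      u-nonNeg : ∀ s → 0# ≤ u s
      u-nonNeg s = x≤y⇒0≤y-x (clip≤ε _)

      clip+u≈ε : ∀ s → clip (sign s * x j) + u s ≈ ε
      clip+u≈ε s = x+[y-x]≈y _ ε

      clip-dot : ∀ s (k : Fin h) → clip (dot (just (j , s , k)) x) ≈ clip (sign s * x j)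
      clip-dot s k = antisym (clip-mono (≤-reflexive (dot-just j s k x))) (clip-mono (≤-reflexive (≈-sym (dot-just j s k x))))

      u≤ε : ∀ s → u s ≤ ε
      u≤ε s = +-cancelˡ-≤ (clip (sign s * x j)) (≤-respˡ (≈-sym (clip+u≈ε s)) (x≤y+x (clip-nonNeg _)))

      u-neg : ∀ s → sign s * x j ≤ 0# → u s ≈ ε
      u-neg s neg = ≈-trans (≈-sym (+-identityˡ _)) (≈-trans (+-congʳ (≈-sym (clip-neg neg))) (clip+u≈ε s))

      unplanted : ∀ s k → (s , k) ≢ lookup z j → rowLoss z x (just (j , s , k)) ≈ u s ^ p
      unplanted s k ≢z rewrite dec-false ((s , k) ≟ˢ lookup z j) ≢z =
        ^-cong (∣x∣-nonNeg _) (x+e≈y⇒∣x-y∣≈e (u-nonNeg s) (≈-trans (+-congʳ (clip-dot s k)) (clip+u≈ε s)))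

      planted : rowLoss z x (just (j , s , k₀)) ≈ (μ + u s) ^ p
      planted rewrite dec-true ((s , k₀) ≟ˢ lookup z j) ≡.refl =
        ^-cong (∣x∣-nonNeg _) (x+e≈y⇒∣x-y∣≈e (+-nonNeg 0≤μ (u-nonNeg s)) (≈-trans (+-congʳ (clip-dot s k₀))
          (≈-trans (solve 3 (λ c m u → c :+ (m :+ u) := (c :+ u) :+ m) ≈-refl _ μ (u s)) (+-congʳ (clip+u≈ε s)))))

      half : Bool → Carrier
      half s′ = sum (λ k → rowLoss z x (just (j , s′ , k)))

      halves : ∀ s → half true + half false ≈ half s + half (not s)
      halves true  = ≈-refl
      halves false = +-comm _ _

      -- The extra `u s ^ p` on the left completes the h - 1 ordinary rows of the hidden sign to
      -- `h`, as in `sum-except`.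
      blockLoss-eq : blockLoss z x j + u s ^ p ≈
        (fromℕ h * u s ^ p + (μ + u s) ^ p) + fromℕ h * u (not s) ^ p
      blockLoss-eq = ≈-trans (+-congʳ (halves s))
          (≈-trans (solve 3 (λ a b c → (a :+ b) :+ c := (a :+ c) :+ b) ≈-refl _ _ _)
          (+-cong (sum-except _ k₀ (λ k k≢ → unplanted s k λ eq → k≢ (≡.cong proj₂ eq)) planted)
            (≈-trans (sum-cong λ k → unplanted (not s) k λ eq → Bool.not-¬ ≡.refl (≡.sym (≡.cong proj₁ eq))) (sum-const h _))))

      0≤u^p : ∀ s → 0# ≤ u s ^ p
      0≤u^p s = ^-nonNeg (u-nonNeg s)

      planted-lower : w + w * (K * u s) ≤ (μ + u s) ^ p
      planted-lower = w+wKu≤[μ+u]^p (u-nonNeg s)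
        (≤-trans (+-monoʳ-≤ μ (≤-trans (u≤ε s) (≤-trans ε≤w w≤μ))) μ+μ≤1)

      -- On the hidden sign the shortfall is all of `ε`, so the hidden row costs at least w + 33 w
      -- ε. Only h - 1 ordinary rows of that sign are present; the missing `ε ^ p` is at most w ε by
      -- `e≤wε`, and 32 w ε remain.
      wrong-lower : sign s * x j ≤ 0# → B + fromℕ 32 * (w * ε) ≤ blockLoss z x j
      wrong-lower neg = +-cancelˡ-≤ (w * ε) (begin
        w * ε + (B + fromℕ 32 * (w * ε))
          ≈⟨ solve 4 (λ he w ε t → w :* ε :+ ((he :+ w) :+ t :* (w :* ε)) := he :+ (w :+ w :* ((con 1 :+ t) :* ε)))
               ≈-refl (fromℕ h * e) w ε (fromℕ 32) ⟩
        fromℕ h * e + (w + w * (K * ε))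
          ≤⟨ +-mono-≤ (≤-reflexive (*-congˡ (^-cong 0≤ε (≈-sym u≈ε))))
               (≤-trans (≤-reflexive (+-congˡ (*-congˡ (*-congˡ (≈-sym u≈ε))))) planted-lower) ⟩
        fromℕ h * u s ^ p + (μ + u s) ^ p
          ≤⟨ x≤x+y (*-nonNeg (fromℕ-nonNeg h) (0≤u^p (not s))) ⟩
        (fromℕ h * u s ^ p + (μ + u s) ^ p) + fromℕ h * u (not s) ^ p
          ≈⟨ blockLoss-eq ⟨
        blockLoss z x j + u s ^ p
          ≈⟨ +-comm _ _ ⟩
        u s ^ p + blockLoss z x j
          ≤⟨ +-monoˡ-≤ _ (≤-trans (≤-reflexive (^-cong (u-nonNeg s) u≈ε)) e≤wε) ⟩
        w * ε + blockLoss z x j ∎)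
        where
        u≈ε : u s ≈ ε
        u≈ε = u-neg s neg

      not-neg : 0# ≤ sign s * x j → sign (not s) * x j ≤ 0#
      not-neg pos = ≤-respˡ (≈-sym (sign-not s (x j))) (0≤x⇒-x≤0 pos)

      -- The opposite sign class pays `h * e` in full, and the ordinary rows of the hidden sign are
      -- dropped. The term in `u s` is kept because it makes every optimal solution saturate the
      -- clip.
      right-lower : 0# ≤ sign s * x j → B + w * (K * u s) ≤ blockLoss z x j
      right-lower pos = +-cancelˡ-≤ (u s ^ p) (begin
        u s ^ p + (B + w * (K * u s))
          ≈⟨ solve 4 (λ a he w t → a :+ ((he :+ w) :+ t) := (a :+ (w :+ t)) :+ he) ≈-refl (u s ^ p) (fromℕ h * e) w _ ⟩
        (u s ^ p + (w + w * (K * u s))) + fromℕ h * e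
          ≤⟨ +-mono-≤ (+-mono-≤ u≤hu planted-lower) (≤-reflexive (*-congˡ (^-cong 0≤ε (≈-sym (u-neg (not s) (not-neg pos)))))) ⟩
        (fromℕ h * u s ^ p + (μ + u s) ^ p) + fromℕ h * u (not s) ^ p
          ≈⟨ ≈-trans (≈-sym blockLoss-eq) (+-comm _ _) ⟩
        u s ^ p + blockLoss z x j ∎)
        where
        u≤hu : u s ^ p ≤ fromℕ h * u s ^ p
        u≤hu = ≤-respˡ (≈-trans (*-congʳ (+-identityʳ 1#)) (*-identityˡ _))
          (*-monoʳ-≤ (0≤u^p s) (fromℕ-mono (ℕ.>-nonZero⁻¹ h)))

      0≤32wε : 0# ≤ fromℕ 32 * (w * ε)
      0≤32wε = *-nonNeg (fromℕ-nonNeg 32) (*-nonNeg (<⇒≤ 0<w) 0≤ε)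

      B≤blockLoss : B ≤ blockLoss z x j
      B≤blockLoss with total (sign s * x j) 0#
      ... | inj₁ neg = ≤-trans (x≤x+y 0≤32wε) (wrong-lower neg)
      ... | inj₂ pos = ≤-trans (x≤x+y (*-nonNeg (<⇒≤ 0<w) (*-nonNeg (<⇒≤ 0<K) (u-nonNeg s)))) (right-lower pos)

      -- A wrong sign would exceed `B` by 32 w ε. With the right sign, `right-lower` forces `u s` to
      -- vanish, so the clip is saturated.
      blockLoss≤B⇒ : blockLoss z x j ≤ B → ε ≤ sign s * x j
      blockLoss≤B⇒ le with total (sign s * x j) 0#
      ... | inj₁ neg = ⊥-elim (*-pos (fromℕ-pos {32} (ℕ.s≤s ℕ.z≤n)) (*-pos 0<w 0<ε)
        (+-cancelˡ-≤ B (≤-trans (wrong-lower neg) (≤-respʳ (≈-sym (+-identityʳ B)) le))))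
      ... | inj₂ pos = clip-large⁻¹ (begin
        ε                            ≈⟨ clip+u≈ε s ⟨
        clip (sign s * x j) + u s    ≤⟨ +-monoʳ-≤ _ u≤0 ⟩
        clip (sign s * x j) + 0#     ≈⟨ +-identityʳ _ ⟩
        clip (sign s * x j)          ∎)
        where
        u≤0 : u s ≤ 0#
        u≤0 = decidable-stable em λ 0<u → *-pos 0<w (*-pos 0<K 0<u)
          (+-cancelˡ-≤ B (≤-trans (right-lower pos) (≤-respʳ (≈-sym (+-identityʳ B)) le)))

      blockLoss≤B : sign s * x j ≈ ε → blockLoss z x j ≤ B
      blockLoss≤B eq = ≤-reflexive (≈-trans (≈-sym (+-identityʳ _)) (≈-trans (+-congˡ (≈-sym u^p≈0))
        (≈-trans blockLoss-eq (≈-trans (+-cong (+-cong (≈-trans (*-congˡ u^p≈0) (zeroʳ _))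
          (^-cong (+-nonNeg 0≤μ (u-nonNeg s)) (≈-trans (+-congˡ u≈0) (+-identityʳ μ))))
          (*-congˡ (^-cong (u-nonNeg (not s)) (u-neg (not s) (not-neg (≤-respʳ (≈-sym eq) 0≤ε))))))
        (solve 2 (λ a w → (con 0 :+ w) :+ a := a :+ w) ≈-refl _ w)))))
        where
        u≈0 : u s ≈ 0#
        u≈0 = ≈-trans (+-congˡ (-‿cong (clip-large (≤-reflexive (≈-sym eq))))) (-‿inverseʳ ε)

        u^p≈0 : u s ^ p ≈ 0#
        u^p≈0 = ≈-trans (^-cong (u-nonNeg s) u≈0) 0^≈0

    open Block using (blockLoss≤B; B≤blockLoss; blockLoss≤B⇒; wrong-lower; 0≤32wε)

    dB : Carrier
    dB = fromℕ d * B

    loss-x⋆≤ : ∀ z → loss p A clip-Lip₁ (b z) (x⋆ z) ≤ dB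
    loss-x⋆≤ z = ≤-respˡ (≈-sym (loss≈blocks z (x⋆ z))) (≤-respʳ (sum-const d B)
      (sum-mono λ j → blockLoss≤B z (x⋆ z) j (sign-sign (proj₁ (lookup z j)) ε)))

    dB≤loss : ∀ z x → dB ≤ loss p A clip-Lip₁ (b z) x
    dB≤loss z x = ≤-respʳ (≈-sym (loss≈blocks z x)) (≤-respˡ (sum-const d B) (sum-mono (B≤blockLoss z x)))

    ∣x⋆∣ : ∀ z j → ∣ x⋆ z j ∣ ≈ ε
    ∣x⋆∣ z j = ≈-trans (∣sign∣ (proj₁ (lookup z j)) ε) (∣x∣≈x 0≤ε)

    -- By `sum-squeeze` an optimal `y` has loss at most `B` in every block, hence every coordinate
    -- of absolute value at least `ε`. As each row has at most one nonzero entry, and that is 1 or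
    -- -1, the norms compare row by row.
    x⋆-isReference : ∀ z → IsReference p A clip-Lip₁ (b z) (x⋆ z)
    x⋆-isReference z = (λ y → ≤-trans (loss-x⋆≤ z) (dB≤loss z y)) , λ y attains →
      sum-mono λ i → ^-mono-≤ (∣x∣-nonNeg _) (rowwise y attains (label r h d i))
      where
      ε≤∣y∣ : ∀ y → AttainsOPT p A clip-Lip₁ (b z) y → ∀ j → ε ≤ ∣ y j ∣
      ε≤∣y∣ y attains j = ≤-respʳ (∣sign∣ (proj₁ (lookup z j)) (y j)) (≤-trans
        (blockLoss≤B⇒ z y j (sum-squeeze (B≤blockLoss z y)
          (≤-respʳ (≈-sym (sum-const d B)) (≤-respˡ (loss≈blocks z y) (≤-trans (attains (x⋆ z)) (loss-x⋆≤ z)))) j))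
        (⊔.x≤x⊔y _ _))

      rowwise : ∀ y → AttainsOPT p A clip-Lip₁ (b z) y → ∀ l → ∣ dot l (x⋆ z) ∣ ≤ ∣ dot l y ∣
      rowwise y attains nothing = ≤-reflexive (∣-∣-cong
        (≈-trans (dot-nothing {d} {h} (x⋆ z)) (≈-sym (dot-nothing {d} {h} y))))
      rowwise y attains (just (j , s , k)) = begin
        ∣ dot (just (j , s , k)) (x⋆ z) ∣ ≈⟨ ≈-trans (∣-∣-cong (dot-just j s k (x⋆ z))) (∣sign∣ s (x⋆ z j)) ⟩
        ∣ x⋆ z j ∣                        ≈⟨ ∣x⋆∣ z j ⟩
        ε                                 ≤⟨ ε≤∣y∣ y attains j ⟩
        ∣ y j ∣                           ≈⟨ ≈-trans (∣-∣-cong (dot-just j s k y)) (∣sign∣ s (y j)) ⟨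
        ∣ dot (just (j , s , k)) y ∣      ∎

    norm-x⋆ : ∀ z → ‖ A · x⋆ z ‖^ p ≈ fromℕ d * (fromℕ h * e + fromℕ h * e)
    norm-x⋆ z = ≈-trans (sum-label r h d (λ l → ∣ dot l (x⋆ z) ∣ ^ p)
        (≈-trans (^-cong (∣x∣-nonNeg _) (≈-trans (∣-∣-cong (dot-nothing {d} {h} (x⋆ z))) (∣x∣≈x ≤-refl))) 0^≈0))
      (≈-trans (sum-cong λ j → +-cong (half j true) (half j false)) (sum-const d _))
      where
      half : ∀ j s → sum {h} (λ k → ∣ dot (just (j , s , k)) (x⋆ z) ∣ ^ p) ≈ fromℕ h * e
      half j s = ≈-trans (sum-cong {h} λ k → ^-cong (∣x∣-nonNeg _)
        (≈-trans (∣-∣-cong (dot-just j s k (x⋆ z))) (≈-trans (∣sign∣ s (x⋆ z j)) (∣x⋆∣ z j)))) (sum-const h e)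

    guess : Carrier → Bool
    guess y = does (em {P = 0# ≤ y})

    correct : Vec (Slot h) d → Vector Carrier d → Fin d → ℕ
    correct z x j = indicator (guess (x j) Bool.≟ proj₁ (lookup z j))

    guess-wrong : ∀ y s → guess y ≢ s → sign s * y ≤ 0#
    guess-wrong y s ≢s with em {P = 0# ≤ y} | s
    ... | yes 0≤y | true  = ⊥-elim (≢s ≡.refl)
    ... | yes 0≤y | false = ≤-respˡ (≈-sym (≈-trans (sign-not true y) (-‿cong (*-identityˡ y)))) (0≤x⇒-x≤0 0≤y)
    ... | no y<0  | true  = ≤-respˡ (≈-sym (*-identityˡ y)) (<⇒≤ y<0)
    ... | no y<0  | false = ⊥-elim (≢s ≡.refl)

    -- Both cases in one inequality that can be summed over the blocks: a correct block gets the
    -- penalty of 32 w ε refunded on the right.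
    block-correct : ∀ z x j → B + fromℕ 32 * (w * ε) ≤ blockLoss z x j + fromℕ (correct z x j) * (fromℕ 32 * (w * ε))
    block-correct z x j with guess (x j) Bool.≟ proj₁ (lookup z j)
    ... | yes _ = +-mono-≤ (B≤blockLoss z x j) (≤-reflexive (≈-sym (≈-trans (*-congʳ (+-identityʳ 1#)) (*-identityˡ _))))
    ... | no ≢s = ≤-trans (wrong-lower z x j (guess-wrong (x j) _ ≢s)) (x≤x+y (≤-reflexive (≈-sym (zeroˡ _))))

    -- Summing `block-correct` gives a loss of at least dB + 32 w ε (d - g) for `g` correct signs,
    -- while accuracy allows at most dB + 4 w ε d. In units of 4 w ε this is 8d ≤ d + 8g.
    success⇒correct : ∀ z x → let OPT = loss p A clip-Lip₁ (b z) (x⋆ z) in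
      loss p A clip-Lip₁ (b z) x ≤ OPT + ε * (OPT + ‖ A · x⋆ z ‖^ p) →
      7 ℕ.* d ℕ.≤ 8 ℕ.* ∑ (allFin d) (correct z x)
    success⇒correct z x le = ℕ.+-cancelˡ-≤ d _ _ (fromℕ-cancel-≤ (d ℕ.+ 7 ℕ.* d) (d ℕ.+ 8 ℕ.* g)
      (*-cancelˡ-≤ (*-pos (fromℕ-pos {4} (ℕ.s≤s ℕ.z≤n)) (*-pos 0<w 0<ε)) (+-cancelˡ-≤ dB (begin
        dB + fromℕ 4 * (w * ε) * fromℕ (8 ℕ.* d)
          ≈⟨ +-congˡ (scale d) ⟩
        dB + fromℕ d * m
          ≈⟨ distribˡ (fromℕ d) B m ⟨
        fromℕ d * (B + m)
          ≈⟨ sum-const d (B + m) ⟨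
        sum {d} (λ _ → B + m)
          ≤⟨ sum-mono (block-correct z x) ⟩
        sum (λ j → blockLoss z x j + fromℕ (correct z x j) * m)
          ≈⟨ ∑-distrib-+ (blockLoss z x) _ ⟩
        sum (blockLoss z x) + sum (λ j → fromℕ (correct z x j) * m)
          ≈⟨ +-cong (≈-sym (loss≈blocks z x)) (sum-fromℕ (correct z x) m) ⟩
        loss p A clip-Lip₁ (b z) x + fromℕ g * m
          ≤⟨ +-monoˡ-≤ _ loss≤ ⟩
        (dB + fromℕ 4 * (w * ε) * fromℕ d) + fromℕ g * m
          ≈⟨ ≈-trans (+-assoc _ _ _) (+-congˡ (+-congˡ (≈-sym (scale g)))) ⟩
        dB + (fromℕ 4 * (w * ε) * fromℕ d + fromℕ 4 * (w * ε) * fromℕ (8 ℕ.* g))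
          ≈⟨ +-congˡ (≈-trans (≈-sym (distribˡ _ _ _)) (*-congˡ (≈-sym (fromℕ-+ d (8 ℕ.* g))))) ⟩
        dB + fromℕ 4 * (w * ε) * fromℕ (d ℕ.+ 8 ℕ.* g) ∎))))
      where
      g : ℕ
      g = ∑ (allFin d) (correct z x)

      m OPT : Carrier
      m = fromℕ 32 * (w * ε)
      OPT = loss p A clip-Lip₁ (b z) (x⋆ z)

      scale : ∀ n → fromℕ 4 * (w * ε) * fromℕ (8 ℕ.* n) ≈ fromℕ n * m
      scale n = ≈-trans (*-congˡ (fromℕ-* 8 n))
        (≈-trans (solve 4 (λ a b c n → a :* c :* (b :* n) := n :* (a :* b :* c)) ≈-refl (fromℕ 4) (fromℕ 8) (w * ε) (fromℕ n))
        (*-congˡ (*-congʳ (≈-sym (fromℕ-* 4 8)))))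

      -- Since h e ≤ w, both the optimum and the norm of the reference are at most 2 w d, whence the
      -- factor 4.
      loss≤ : loss p A clip-Lip₁ (b z) x ≤ dB + fromℕ 4 * (w * ε) * fromℕ d
      loss≤ = begin
        loss p A clip-Lip₁ (b z) x
          ≤⟨ le ⟩
        OPT + ε * (OPT + ‖ A · x⋆ z ‖^ p)
          ≤⟨ +-mono-≤ (loss-x⋆≤ z) (*-monoˡ-≤ 0≤ε (+-mono-≤ (loss-x⋆≤ z) (≤-reflexive (norm-x⋆ z)))) ⟩
        dB + ε * (dB + fromℕ d * (fromℕ h * e + fromℕ h * e))
          ≤⟨ +-monoʳ-≤ dB (*-monoˡ-≤ 0≤ε (+-mono-≤ (*-monoˡ-≤ (fromℕ-nonNeg d) (+-monoˡ-≤ w hε^p≤w))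
               (*-monoˡ-≤ (fromℕ-nonNeg d) (+-mono-≤ hε^p≤w hε^p≤w)))) ⟩
        dB + ε * (fromℕ d * (w + w) + fromℕ d * (w + w))
          ≈⟨ +-congˡ (solve 3 (λ ε d w → ε :* (d :* (w :+ w) :+ d :* (w :+ w))
               := (con 1 :+ (con 1 :+ (con 1 :+ (con 1 :+ con 0)))) :* (w :* ε) :* d) ≈-refl ε (fromℕ d) w) ⟩
        dB + fromℕ 4 * (w * ε) * fromℕ d ∎

-- From the hard instance to the query lower bound

module LowerBound (em : ∀ {ℓ} → ExcludedMiddle ℓ) (ℝ : CompleteOrderedField)
  (p : CompleteOrderedField.Carrier ℝ) (2<p : CompleteOrderedField._<_ ℝ (CompleteOrderedField.fromℕ ℝ 2) p) where

  open Counting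
  open Field em ℝ
  open HardInstance em ℝ p 2<p
  open Power em ℝ p 2<p
  open Queries em ℝ
  open Reals ℝ using (RandomizedAlgorithm; Succeeds; IsReference; queryCount)
  open import Data.Empty using (⊥)

  -- With `h` about w/e, the blocks take 2 h d ≤ 2 w d/e rows, which gives `C`. As w/e ≤ h + 1 ≤ 2h,
  -- the budget d h/8 is at least w d/(16 e), which gives `c`.
  C c : Carrier
  C = fromℕ 2 * w
  c = w / fromℕ 16

  0<C : 0# < C
  0<C = *-pos (fromℕ-pos {2} (ℕ.s≤s ℕ.z≤n)) 0<w

  0<16 : 0# < fromℕ 16
  0<16 = fromℕ-pos {16} (ℕ.s≤s ℕ.z≤n)

  0<c : 0# < c
  0<c = *-pos 0<w (⁻¹-pos 0<16)

  HasExpensiveInput : (n d : ℕ) (bound : Carrier) → RandomizedAlgorithm n d → Set₁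
  HasExpensiveInput n d bound alg = let open RandomizedAlgorithm alg in
    ∃[ A ] ∃[ f ] ∃[ b ] (∃[ x* ] IsReference p A f b x*) ×
      WithPositiveProbability (λ ω → bound ≤ fromℕ (queryCount (tree A f ω) b))

  module _ (ε : Carrier) (0<ε : 0# < ε) (ε≤w : ε ≤ w) (h r d : ℕ) .{{_ : NonZero h}}
    (hε^p≤w : fromℕ h * ε ^ p ≤ w) (bound : Carrier) (8bound≤dh : fromℕ 8 * bound ≤ fromℕ (d ℕ.* h))
    (trivial : d ≡ 0 → bound ≤ 0#)
    (alg : RandomizedAlgorithm (rows r h d) d) (succeeds : Succeeds p ε alg) where

    open Instance ε 0<ε ε≤w h hε^p≤w r d
    open Clip ε 0<ε using (clip-Lip₁)
    open RandomizedAlgorithm alg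
    open Measure em ℝ space

    Expensive Success : Vec (Slot h) d → Pred Ω 0ℓ
    Expensive z ω = bound ≤ fromℕ (queryCount (tree A clip-Lip₁ ω) (b z))
    Success z = proj₁ (succeeds A clip-Lip₁ (b z) (x⋆ z) (x⋆-isReference z))

    module _ (cheap : ∀ z → ¬ WithPositiveProbability (Expensive z)) where

      -- Positive probability is phrased by outer measure, so its negation yields, classically, a
      -- measurable null event that covers the expensive runs.
      null : ∀ z → ∃[ G ] Measurable G × Expensive z ⊆ G × ℙ G ≤ 0#
      null z = decidable-stable em λ none → cheap z λ {F} mF E⊆F ℙF≤0 → none (F , mF , (λ {ω} → E⊆F {ω}) , ℙF≤0)

      -- A measurable event on which the run is both accurate and cheap, and which is still as
      -- likely as success.
      Good : Vec (Slot h) d → Pred Ω 0ℓ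
      Good z = Success z ∩ ∁ (proj₁ (null z))

      Good-measurable : ∀ z → Measurable (Good z)
      Good-measurable z =
        let _ , mF , _ = succeeds A clip-Lip₁ (b z) (x⋆ z) (x⋆-isReference z)
            _ , mG , _ = null z
        in measurable-∩ mF (measurable-∁ mG)

      Good-likely : ∀ z → fromℕ 4 / fromℕ 5 ≤ ℙ (Good z)
      Good-likely z =
        let _ , mF , _ , q≤ = succeeds A clip-Lip₁ (b z) (x⋆ z) (x⋆-isReference z)
            _ , mG , _ , ℙG≤0 = null z
        in ≤-trans q≤ (ℙ-∖-null mF mG ℙG≤0)

      Good-cheap : ∀ {ω} z → Good z ω → fromℕ (queryCount (tree A clip-Lip₁ ω) (b z)) < bound
      Good-cheap z (_ , ¬null) le = ¬null (proj₁ (proj₂ (proj₂ (null z))) le)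

      Good-few : ∀ {ω} z → Good z ω → 8 ℕ.* queryCount (tree A clip-Lip₁ ω) (b z) ℕ.≤ d ℕ.* h
      Good-few {ω} z good = fromℕ-cancel-≤ (8 ℕ.* q) (d ℕ.* h) (≤-trans (≤-reflexive (fromℕ-* 8 q))
        (≤-trans (*-monoˡ-≤ (fromℕ-nonNeg 8) (<⇒≤ (Good-cheap z good))) 8bound≤dh))
        where
        q : ℕ
        q = queryCount (tree A clip-Lip₁ ω) (b z)

      rarely-good : ∀ d′ → d′ ≡ d → ∀ ω →
        7 ℕ.* multiplicity Good Good-measurable (inputs d h) ω ℕ.≤ 5 ℕ.* length (inputs d h)
      -- `few-good` divides by `d`, so `d = 0` is separate. The bound is then at most 0, no run
      -- makes fewer queries than that, and nothing is good.
      rarely-good zero ≡.refl ω = ℕ.≤-trans (ℕ.≤-reflexive (≡.cong (7 ℕ.*_) never)) ℕ.z≤n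
        where
        never : multiplicity Good Good-measurable (inputs d h) ω ≡ 0
        never = ≡.trans
          (∑-cong (inputs d h) λ z → indicator-no (em {P = Good z ω}) λ good →
            Good-cheap z good (≤-trans (trivial ≡.refl) (fromℕ-nonNeg (queryCount (tree A clip-Lip₁ ω) (b z)))))
          (≡.trans (∑-const (inputs d h) 0) (ℕ.*-zeroʳ (length (inputs d h))))
      rarely-good (suc _) ≡.refl ω = few-good (label r h d) ε (ε + μ) guess (tree A clip-Lip₁ ω) (λ z → Good z ω)
        (λ z → Good-few z)
        (λ z good → success⇒correct z _
          (proj₁ (proj₂ (proj₂ (succeeds A clip-Lip₁ (b z) (x⋆ z) (x⋆-isReference z)))) (proj₁ good)))

      -- Averaging over the runs gives 7 (4/5) N ≤ 5 N, that is 28 N ≤ 25 N, although N is at least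
      -- 1.
      impossible : ⊥
      impossible = ℕ.n≮n 25 (ℕ.*-cancelʳ-≤ 26 25 N {{ℕ.>-nonZero (inputs-nonempty d h)}}
        (ℕ.≤-trans (ℕ.*-monoˡ-≤ N (ℕ.m≤m+n 26 2)) 28N≤25N))
        where
        N : ℕ
        N = length (inputs d h)

        28N≤25N : 28 ℕ.* N ℕ.≤ 25 ℕ.* N
        28N≤25N = fromℕ-cancel-≤ (28 ℕ.* N) (25 ℕ.* N) (begin
          fromℕ (28 ℕ.* N)
            ≈⟨ ≈-trans (fromℕ-* 28 N) (*-congʳ (fromℕ-* 7 4)) ⟩
          fromℕ 7 * fromℕ 4 * fromℕ N
            ≈⟨ *-congʳ (*-congˡ (/-cancel (fromℕ-pos {5} (ℕ.s≤s ℕ.z≤n)))) ⟨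
          fromℕ 7 * (fromℕ 5 * (fromℕ 4 / fromℕ 5)) * fromℕ N
            ≈⟨ solve 4 (λ a b q n → a :* (b :* q) :* n := b :* (a :* (n :* q))) ≈-refl (fromℕ 7) (fromℕ 5) _ (fromℕ N) ⟩
          fromℕ 5 * (fromℕ 7 * (fromℕ N * (fromℕ 4 / fromℕ 5)))
            ≤⟨ *-monoˡ-≤ (fromℕ-nonNeg 5) (multiplicity-bound Good Good-measurable 7 (5 ℕ.* N) (inputs d h)
                 Good-likely (rarely-good d ≡.refl)) ⟩
          fromℕ 5 * fromℕ (5 ℕ.* N)
            ≈⟨ ≈-trans (*-congˡ (fromℕ-* 5 N)) (≈-trans (≈-sym (*-assoc _ _ _)) (*-congʳ (≈-sym (fromℕ-* 5 5)))) ⟩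
          fromℕ 25 * fromℕ N
            ≈⟨ fromℕ-* 25 N ⟨
          fromℕ (25 ℕ.* N) ∎)

    expensive-input : HasExpensiveInput (rows r h d) d bound alg
    expensive-input = decidable-stable em λ none → impossible λ z positive →
      none (A , clip-Lip₁ , b z , (x⋆ z , x⋆-isReference z) , λ {F} → positive {F})

  transport : ∀ {m n d ε bound} → m ≡ n →
    ((alg : RandomizedAlgorithm m d) → Succeeds p ε alg → HasExpensiveInput m d bound alg) →
    (alg : RandomizedAlgorithm n d) → Succeeds p ε alg → HasExpensiveInput n d bound alg
  transport ≡.refl f = f

  module _ (ε : Carrier) (0<ε : 0# < ε) (ε≤w : ε ≤ w) where

    private
      e : Carrier
      e = ε ^ p

    0<e : 0# < e
    0<e = ^-pos 0<ε (≤-trans ε≤w w≤1)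

    -- Makes w/e at least 2, so that rounding down leaves at least one row of each sign per block.
    -- It follows from e ≤ ε * ε ≤ w * μ and 2 μ ≤ 1.
    2e≤w : fromℕ 2 * e ≤ w
    2e≤w = begin
      fromℕ 2 * e          ≤⟨ *-monoˡ-≤ (fromℕ-nonNeg 2) (^≤square (<⇒≤ 0<ε) (≤-trans ε≤w w≤1)) ⟩
      fromℕ 2 * (ε * ε)    ≤⟨ *-monoˡ-≤ (fromℕ-nonNeg 2) (*-mono-≤ (<⇒≤ 0<ε) (<⇒≤ 0<w) ε≤w (≤-trans ε≤w w≤μ)) ⟩
      fromℕ 2 * (w * μ)    ≈⟨ solve 2 (λ w m → (con 1 :+ (con 1 :+ con 0)) :* (w :* m) := w :* (m :+ m)) ≈-refl w μ ⟩
      w * (μ + μ)          ≤⟨ *-monoˡ-≤ (<⇒≤ 0<w) μ+μ≤1 ⟩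
      w * 1#               ≈⟨ *-identityʳ w ⟩
      w                    ∎

    module _ (n d h : ℕ) (h≤w/e : fromℕ h ≤ w / e) (w/e≤1+h : w / e ≤ fromℕ (suc h))
      (large : C * (fromℕ d / e) ≤ fromℕ n) where

      1≤h : 1 ℕ.≤ h
      1≤h = ℕ.s≤s⁻¹ (fromℕ-cancel-≤ 2 (suc h) (≤-trans (*-cancelˡ-≤ 0<e (begin
        e * fromℕ 2    ≈⟨ *-comm _ _ ⟩
        fromℕ 2 * e    ≤⟨ 2e≤w ⟩
        w              ≈⟨ /-cancel 0<e ⟨
        e * (w / e)    ∎)) w/e≤1+h))

      he≤w : fromℕ h * e ≤ w
      he≤w = ≤-respˡ (*-comm e _) (≤-respʳ (/-cancel 0<e) (*-monoˡ-≤ (<⇒≤ 0<e) h≤w/e))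

      enough-rows : d ℕ.* (2 ℕ.* h) ℕ.≤ n
      enough-rows = fromℕ-cancel-≤ (d ℕ.* (2 ℕ.* h)) n (begin
        fromℕ (d ℕ.* (2 ℕ.* h))            ≈⟨ ≈-trans (fromℕ-* d _) (*-congˡ (fromℕ-* 2 h)) ⟩
        fromℕ d * (fromℕ 2 * fromℕ h)      ≤⟨ *-monoˡ-≤ (fromℕ-nonNeg d) (*-monoˡ-≤ (fromℕ-nonNeg 2) h≤w/e) ⟩
        fromℕ d * (fromℕ 2 * (w / e))      ≈⟨ solve 4 (λ d t w e → d :* (t :* (w :* e)) := (t :* w) :* (d :* e)) ≈-refl (fromℕ d) (fromℕ 2) w (e ⁻¹) ⟩
        C * (fromℕ d / e)                  ≤⟨ large ⟩
        fromℕ n                            ∎)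

      padding : ∃[ r ] rows r h d ≡ n
      padding = let r , eq = ℕ.m≤n⇒∃[o]m+o≡n enough-rows in r , ≡.trans (≡.sym (rows≡ r h d)) eq

      bound : Carrier
      bound = c * (fromℕ d / e)

      8bound≤dh : fromℕ 8 * bound ≤ fromℕ (d ℕ.* h)
      8bound≤dh = *-cancelˡ-≤ (fromℕ-pos {2} (ℕ.s≤s ℕ.z≤n)) (begin
        fromℕ 2 * (fromℕ 8 * bound)        ≈⟨ ≈-trans (≈-sym (*-assoc _ _ _)) (*-congʳ (≈-sym (fromℕ-* 2 8))) ⟩
        fromℕ 16 * (c * (fromℕ d / e))     ≈⟨ ≈-trans (≈-sym (*-assoc _ _ _)) (*-congʳ (/-cancel 0<16)) ⟩
        w * (fromℕ d / e)                  ≈⟨ solve 3 (λ w d e → w :* (d :* e) := d :* (w :* e)) ≈-refl w (fromℕ d) (e ⁻¹) ⟩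
        fromℕ d * (w / e)                  ≤⟨ *-monoˡ-≤ (fromℕ-nonNeg d) (≤-trans w/e≤1+h 1+h≤2h) ⟩
        fromℕ d * fromℕ (2 ℕ.* h)          ≈⟨ *-congˡ (fromℕ-* 2 h) ⟩
        fromℕ d * (fromℕ 2 * fromℕ h)      ≈⟨ solve 3 (λ d t h → d :* (t :* h) := t :* (d :* h)) ≈-refl (fromℕ d) (fromℕ 2) (fromℕ h) ⟩
        fromℕ 2 * (fromℕ d * fromℕ h)      ≈⟨ *-congˡ (fromℕ-* d h) ⟨
        fromℕ 2 * fromℕ (d ℕ.* h)          ∎)
        where
        1+h≤2h : fromℕ (suc h) ≤ fromℕ (2 ℕ.* h)
        1+h≤2h = fromℕ-mono (ℕ.≤-trans (ℕ.+-monoˡ-≤ h 1≤h) (ℕ.≤-reflexive (≡.cong (h ℕ.+_) (≡.sym (ℕ.+-identityʳ h)))))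

      trivial : d ≡ 0 → bound ≤ 0#
      trivial d≡0 = ≤-reflexive (≈-trans (*-congˡ (≈-trans (*-congʳ (≈-reflexive (≡.cong fromℕ d≡0))) (zeroˡ _))) (zeroʳ c))

      expensive-input-padded : (alg : RandomizedAlgorithm n d) → Succeeds p ε alg → HasExpensiveInput n d bound alg
      expensive-input-padded = transport (proj₂ padding)
        (expensive-input ε 0<ε ε≤w h (proj₁ padding) d {{ℕ.>-nonZero 1≤h}} he≤w bound 8bound≤dh trivial)

    lower-bound : ∀ n d → C * (fromℕ d / ε ^ p) ≤ fromℕ n →
      (alg : RandomizedAlgorithm n d) → Succeeds p ε alg → HasExpensiveInput n d (c * (fromℕ d / ε ^ p)) alg
    lower-bound n d large =
      let h , h≤w/e , w/e≤1+h = floor (*-nonNeg (<⇒≤ 0<w) (<⇒≤ (⁻¹-pos 0<e)))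
      in expensive-input-padded n d h h≤w/e w/e≤1+h large

theorem3 : (∀ {ℓ} → ExcludedMiddle ℓ) → (ℝ : CompleteOrderedField) →
    let open Reals ℝ in
    ∀ p → fromℕ 2 < p →
    ∃[ c ] ∃[ C ] ∃[ ε₀ ] 0# < c × 0# < C × 0# < ε₀ ×
    (∀ ε → 0# < ε → ε ≤ ε₀ →
    ∀ (n d : ℕ) → C * (fromℕ d / ε ^ p) ≤ fromℕ n →
    (alg : RandomizedAlgorithm n d) → Succeeds p ε alg →
    let open RandomizedAlgorithm alg in
    ∃[ A ] ∃[ f ] ∃[ b ] (∃[ x* ] IsReference p A f b x*) ×
    WithPositiveProbability (λ ω →
    c * (fromℕ d / ε ^ p) ≤ fromℕ (queryCount (tree A f ω) b)))
-- All three constants are built from `w`, the p-th power of 1/33, and so depend on `p` alone; `w`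
-- itself is the threshold for `ε`.
theorem3 em ℝ p 2<p = c , C , w , 0<c , 0<C , 0<w , lower-bound
  where
  open LowerBound em ℝ p 2<p
  open HardInstance em ℝ p 2<p using (w; 0<w)
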